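{- Let $T$ be a finite tree and let $k\ge 3$ be an integer. Then $\tilde{r}_k(T)\le (k-1)\,\tilde{r}_2(T)$.
   Context: All graphs are finite, simple and undirected. For a graph $G$, a set $U\subseteq V(G)$ is $P_3$-convex if every vertex of $G$ not in $U$ has at most one neighbour in $U$ (equivalently, $U$ contains the middle vertex of every path on three vertices whose two ends lie in $U$). The convex hull $H_G(S)$ of $S\subseteq V(G)$ is the intersection of all $P_3$-convex sets containing $S$; for a multi-set of vertices, its convex hull is the convex hull of its underlying set. For a multi-set $R$ of vertices of $G$ and an integer $k\ge 2$, a $k$-Radon partition of $R$ is a partition of $R$ (as a multi-set, so each copy of an element is placed in exactly one part) into $k$ multi-sets $R_1,\dots,R_k$ such that $H_G(R_1)\cap\cdots\cap H_G(R_k)\neq\emptyset$. A multi-set is $k$-anti-Radon if it has no $k$-Radon partition. $\tilde{r}_k(G)$ denotes the maximum size (counted with multiplicity) of a $k$-anti-Radon multi-set of vertices of $G$. (For $k=2$ such a multi-set has no repeated elements, so $\tilde r_2(G)$ is the maximum size of a set of vertices with no partition into two parts whose convex hulls intersect.) -}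

module Defs where

open import Data.Nat using (ℕ; _≤_)
open import Data.Bool using (Bool; T; false)
open import Data.Fin using (Fin)
open import Data.Fin.Subset using (Subset; _∈_; _∉_)
open import Data.List using (List; []; _∷_; _++_; [_]; length; lookup)
open import Data.List.Relation.Unary.Unique.Propositional using (Unique)
open import Data.List.Relation.Unary.Linked using (Linked)
open import Data.Product using (Σ; ∃; _×_)
open import Data.Empty using (⊥)
open import Relation.Nullary using (¬_)
open import Relation.Binary.PropositionalEquality using (_≡_)

record Graph (n : ℕ) : Set where
  field
    adj     : Fin n → Fin n → Bool
    adj-sym : ∀ u v → adj u v ≡ adj v u
    adj-irr : ∀ v → adj v v ≡ false

module _ {n : ℕ} (G : Graph n) where
  open Graph G

  Adj : Fin n → Fin n → Set
  Adj u v = T (adj u v)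

  data Walk : Fin n → Fin n → Set where
    nil  : ∀ {u} → Walk u u
    cons : ∀ {u v w} → Adj u v → Walk v w → Walk u w

  Connected : Set
  Connected = ∀ u v → Walk u v

  HasCycle : Set
  HasCycle = Σ (Fin n) λ x → Σ (List (Fin n)) λ vs →
    (2 ≤ length vs) × Unique (x ∷ vs) × Linked Adj (x ∷ vs ++ [ x ])

  Acyclic : Set
  Acyclic = ¬ HasCycle

  IsTree : Set
  IsTree = (1 ≤ n) × Connected × Acyclic

  IsConvex : Subset n → Set
  IsConvex U = ∀ v → v ∉ U → ∀ a b → a ∈ U → b ∈ U → Adj v a → Adj v b → a ≡ b

  InHull : (Fin n → Set) → Fin n → Set
  InHull S x = ∀ (U : Subset n) → IsConvex U → (∀ y → S y → y ∈ U) → x ∈ U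

  -- A multi-set of vertices is a list R; a partition of R into k multi-sets is an
  -- assignment f of each position of R to a part in Fin k.
  -- Underlying set of part i:
  Part : (R : List (Fin n)) {k : ℕ} → (Fin (length R) → Fin k) → Fin k → Fin n → Set
  Part R f i y = ∃ λ j → lookup R j ≡ y × f j ≡ i

  IsRadonPartition : (k : ℕ) (R : List (Fin n)) → (Fin (length R) → Fin k) → Set
  IsRadonPartition k R f = ∃ λ x → ∀ (i : Fin k) → InHull (Part R f i) x

  AntiRadon : ℕ → List (Fin n) → Set
  AntiRadon k R = ¬ (∃ λ (f : Fin (length R) → Fin k) → IsRadonPartition k R f)

{-# OPTIONS --safe #-}

-- Let t = k − 1. In a tree a vertex v lies in the hull of a set exactly when v is in
-- the set or two neighbours x, y of v are generated by the parts of the set in their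
-- own branches at v. For a directed edge v → w let a(v → w) be the number of disjoint
-- parts of R, inside the branch of v, that generate v. If the neighbours send
-- α₁, α₂, … to v, then q of the parts can be paired off at v as soon as
-- Σ min(αᵢ, q) ≥ 2q, so a k-anti-Radon R satisfies Σ min(αᵢ, q + 1) ≤ 2q + 1 for
-- q = t − mult R v, and similar bounds on every outgoing message.
--
-- Each branch v → w carries a number F and a kind. F is the size of a 2-anti-Radon
-- set in the branch that sends nothing to w and may receive a message from w, and
-- F + gain is the size of one that sends a message to w and, if the kind is loose,
-- may receive one. With a = a(v → w) and b = a(w → v), the part of R in the branch has
-- size at most t F + d, where d is 0 (null), a (loose), min(a, t − b) (tight) or
-- a + min(a, t − b) (double). The kinds of the branches below v determine the kind of
-- v, and at the root a ≤ t makes the bound t (F + gain).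

module Submission where

open import Defs
open import Data.Bool using (Bool; true; false; T; if_then_else_)
open import Data.Empty using (⊥; ⊥-elim)
open import Data.Fin using (Fin; zero; suc; _≟_; toℕ; fromℕ<)
open import Data.Fin.Properties using (any?; injective⇒≤; toℕ<n; fromℕ<-toℕ)
open import Data.Fin.Subset using (Subset) renaming (_∈_ to _∈ˢ_)
open import Data.Fin.Subset.Properties using () renaming (_∈?_ to _∈ˢ?_)
open import Data.List using (List; []; _∷_; _++_; [_]; length; lookup; concat; tabulate; map)
open import Data.List.Properties using (length-++; map-++)
import Data.List.Membership.DecPropositional as DecMembership
open import Data.List.Membership.Propositional using (_∈_; _∉_)
open import Data.List.Membership.Propositional.Properties
  using (∈-∃++; ∈-lookup; ∈-concat⁺′; ∈-concat⁻′; ∈-tabulate⁺; ∈-tabulate⁻; ∈-++⁻; ∈-++⁺ʳ)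
open import Data.List.Relation.Unary.All as All using ([]; _∷_)
import Data.List.Relation.Unary.All.Properties as All
open import Data.List.Relation.Unary.AllPairs using ([]; _∷_)
import Data.List.Relation.Unary.AllPairs.Properties as AllPairs
open import Data.List.Relation.Unary.Any using (here; there; index)
open import Data.List.Relation.Unary.Any.Properties using (lookup-index)
open import Data.List.Relation.Unary.Linked using (Linked; [-]; _∷_)
open import Data.List.Relation.Unary.Unique.Propositional using (Unique)
open import Data.List.Relation.Unary.Unique.Propositional.Properties using (concat⁺; ++⁺)
open import Data.Nat using (ℕ; zero; suc; _+_; _*_; _∸_; _⊓_; _≤_; _<_; z≤n; s≤s; _≤?_; _<?_)
open import Data.Nat.ListAction using () renaming (sum to sumˡ)
open import Data.Nat.ListAction.Properties using (sum-++)
open import Data.Nat.Properties hiding (_≟_)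
open import Data.Nat.Tactic.RingSolver using (solve-∀)
open import Data.Product using (Σ; ∃; ∃₂; _×_; _,_; proj₁; proj₂)
open import Data.Sum using (_⊎_; inj₁; inj₂)
import Data.Vec as Vec
open import Data.Vec.Functional using (updateAt)
open import Data.Vec.Functional.Properties using (updateAt-updates; updateAt-minimal)
open import Data.Vec.Properties using (lookup∘tabulate; []=⇒lookup; lookup⇒[]=)
open import Function using (_∘_; const)
open import Relation.Binary.PropositionalEquality hiding ([_])
open import Relation.Nullary using (¬_; Dec; yes; no; does; contradiction; ¬?; _×-dec_; _⊎-dec_)
open import Relation.Nullary.Decidable using (T?; map′; dec-true; dec-false; decidable-stable)
open import Algebra.Properties.CommutativeMonoid.Sum +-0-commutativeMonoid
  using (sum; ∑-distrib-+; sum-cong-≗)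
open import Algebra.Properties.Semiring.Sum +-*-semiring using (*-distribˡ-sum)

-- Sums over a finite index set and capped sums.

sum-mono : ∀ {n} {f g : Fin n → ℕ} → (∀ u → f u ≤ g u) → sum f ≤ sum g
sum-mono {zero}  f≤g = z≤n
sum-mono {suc n} f≤g = +-mono-≤ (f≤g zero) (sum-mono (f≤g ∘ suc))

infixl 9 _[_]≔_
_[_]≔_ : ∀ {n} → (Fin n → ℕ) → Fin n → ℕ → Fin n → ℕ
f [ i ]≔ x = updateAt f i (const x)

sum-zero : ∀ {n} {f : Fin n → ℕ} → (∀ u → f u ≡ 0) → sum f ≡ 0
sum-zero {zero}  f≡0 = refl
sum-zero {suc n} f≡0 = cong₂ _+_ (f≡0 zero) (sum-zero (f≡0 ∘ suc))

sum-split : ∀ {n} (f : Fin n → ℕ) i → sum f ≡ f i + sum (f [ i ]≔ 0)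
sum-split f zero    = refl
sum-split f (suc i) = begin
  f zero + sum (f ∘ suc)                                ≡⟨ cong (f zero +_) (sum-split (f ∘ suc) i) ⟩
  f zero + (f (suc i) + sum ((f ∘ suc) [ i ]≔ 0))       ≡⟨ swap (f zero) (f (suc i)) _ ⟩
  f (suc i) + (f zero + sum ((f ∘ suc) [ i ]≔ 0))       ∎
  where
  open ≡-Reasoning
  swap : ∀ a b c → a + (b + c) ≡ b + (a + c)
  swap = solve-∀

single : ∀ {n} → Fin n → ℕ → Fin n → ℕ
single i x = const 0 [ i ]≔ x

single-at : ∀ {n} (i : Fin n) x → single i x i ≡ x
single-at i x = updateAt-updates i (const 0)

update-at : ∀ {n} (f : Fin n → ℕ) i x → (f [ i ]≔ x) i ≡ x
update-at f i x = updateAt-updates i f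

update-off : ∀ {n} (f : Fin n → ℕ) i x {u} → u ≢ i → (f [ i ]≔ x) u ≡ f u
update-off f i x u≢i = updateAt-minimal _ i f u≢i

update-elim : ∀ {n} (P : Fin n → ℕ → Set) (f : Fin n → ℕ) i x →
  P i x → (∀ u → u ≢ i → P u (f u)) → ∀ u → P u ((f [ i ]≔ x) u)
update-elim P f i x Pi Pu u with u ≟ i
... | yes refl = subst (P i) (sym (update-at f i x)) Pi
... | no u≢i   = subst (P u) (sym (update-off f i x u≢i)) (Pu u u≢i)

sum-single : ∀ {n} (i : Fin n) x → sum (single i x) ≡ x
sum-single i x = begin
  sum (single i x)                              ≡⟨ sum-split (single i x) i ⟩
  single i x i + sum (single i x [ i ]≔ 0)      ≡⟨ cong₂ _+_ (single-at i x) (sum-zero vanish) ⟩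
  x + 0                                         ≡⟨ +-identityʳ x ⟩
  x                                             ∎
  where
  open ≡-Reasoning
  vanish : ∀ u → (single i x [ i ]≔ 0) u ≡ 0
  vanish = update-elim (λ _ y → y ≡ 0) (single i x) i 0 refl (λ u u≢i → update-off (const 0) i x u≢i)

sum-≤-single : ∀ {n} {f g : Fin n → ℕ} i x →
  (∀ u → f u ≤ g u + single i x u) → sum f ≤ sum g + x
sum-≤-single {f = f} {g} i x h = begin
  sum f                          ≤⟨ sum-mono h ⟩
  sum (λ u → g u + single i x u) ≡⟨ ∑-distrib-+ g (single i x) ⟩
  sum g + sum (single i x)       ≡⟨ cong (sum g +_) (sum-single i x) ⟩
  sum g + x                      ∎
  where open ≤-Reasoning

term≤sum : ∀ {n} (f : Fin n → ℕ) i → f i ≤ sum f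
term≤sum f i = subst (f i ≤_) (sym (sum-split f i)) (m≤m+n (f i) _)

cap : ∀ {n} → ℕ → (Fin n → ℕ) → Fin n → ℕ
cap q y u = y u ⊓ q

-- q disjoint pairs of units with distinct indices can be formed from y exactly when
-- q + q ≤ sum (cap q y); Optimal y q says that q is the largest such number.
Optimal : ∀ {n} → (Fin n → ℕ) → ℕ → Set
Optimal y q = q + q ≤ sum (cap q y) × sum (cap (suc q) y) ≤ suc (q + q)

optimum : ∀ {n} (y : Fin n → ℕ) → ∃ (Optimal y)
-- At N = `suc (sum y)` the inequality N + N ≤ `sum (cap N y)` ≤ `sum y` is impossible, so an upward
-- search from zero meets its first failure by then.
optimum y with search (suc (sum y))
  where
  search : ∀ N → ∃ (Optimal y) ⊎ N + N ≤ sum (cap N y)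
  search zero = inj₂ z≤n
  search (suc N) with search N
  ... | inj₁ found = inj₁ found
  ... | inj₂ h with suc N + suc N ≤? sum (cap (suc N) y)
  ...   | yes h′ = inj₂ h′
  ...   | no ¬h′ = inj₁ (N , h , subst (sum (cap (suc N) y) ≤_) (+-suc N N) (≤-pred (≰⇒> ¬h′)))
... | inj₁ found = found
... | inj₂ h = contradiction (≤-trans (m≤m+n _ _) (≤-trans h (sum-mono λ u → m⊓n≤m (y u) _))) 1+n≰n

-- A value above q + 1 would by itself contribute q + 1 to the capped sum, so the cap changes
-- nothing.
cap-slack : ∀ {n} (y : Fin n → ℕ) q → sum (cap (suc q) y) ≤ q → sum y ≤ q
cap-slack y q h = subst (_≤ q) (sum-cong-≗ uncapped) h
  where
  uncapped : ∀ u → y u ⊓ suc q ≡ y u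
  uncapped u with y u ≤? suc q
  ... | yes y≤ = m≤n⇒m⊓n≡m y≤
  ... | no y≰  = contradiction
    (≤-trans (≤-reflexive (sym (m≥n⇒m⊓n≡n (≰⇒≥ y≰)))) (≤-trans (term≤sum (cap (suc q) y) u) h)) 1+n≰n

cancel-≤ : ∀ {L R c d} C → L ≤ R → L ≡ C + c → R ≡ C + d → c ≤ d
cancel-≤ {c = c} {d} C L≤R p q = +-cancelˡ-≤ C c d (subst₂ _≤_ p q L≤R)

-- If no value exceeds q + 1 then capping changes nothing; if one does, it uses
-- up q + 1 of the budget and the remaining values sum to at most q.
dichotomy : ∀ {n} (y : Fin n → ℕ) t q → (∀ u → y u ≤ t) →
  sum (cap (suc q) y) ≤ suc (q + q) → sum y ≤ suc (q + q) ⊎ sum y ≤ t + q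
dichotomy y t q y≤t h with any? (λ u → suc q <? y u)
... | no ¬large = inj₁ (subst (_≤ suc (q + q)) (sum-cong-≗ λ u → m≤n⇒m⊓n≡m (≮⇒≥ λ l → ¬large (u , l))) h)
... | yes (u , large) = inj₂ (begin
  sum y                      ≡⟨ sum-split y u ⟩
  y u + sum (y [ u ]≔ 0)     ≤⟨ +-mono-≤ (y≤t u) (cap-slack (y [ u ]≔ 0) q rest) ⟩
  t + q                      ∎)
  where
  open ≤-Reasoning
  same : ∀ v → cap (suc q) (y [ u ]≔ 0) v ≡ (cap (suc q) y [ u ]≔ 0) v
  same v with v ≟ u
  ... | yes refl = trans (cong (_⊓ suc q) (update-at y u 0)) (sym (update-at (cap (suc q) y) u 0))
  ... | no v≢u   = trans (cong (_⊓ suc q) (update-off y u 0 v≢u)) (sym (update-off (cap (suc q) y) u 0 v≢u))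
  total : suc q + sum (cap (suc q) (y [ u ]≔ 0)) ≤ suc q + q
  total = begin
    suc q + sum (cap (suc q) (y [ u ]≔ 0))               ≡⟨ cong₂ _+_ (sym (m≥n⇒m⊓n≡n (<⇒≤ large))) (sum-cong-≗ same) ⟩
    cap (suc q) y u + sum (cap (suc q) y [ u ]≔ 0)       ≡⟨ sym (sum-split (cap (suc q) y) u) ⟩
    sum (cap (suc q) y)                                  ≤⟨ h ⟩
    suc q + q                                            ∎
  rest : sum (cap (suc q) (y [ u ]≔ 0)) ≤ q
  rest = +-cancelˡ-≤ (suc q) _ _ total

prefix : ∀ {n} → (Fin n → ℕ) → Fin n → ℕ
prefix y zero    = 0
prefix y (suc u) = y zero + prefix (y ∘ suc) u

-- Blocks of lengths `y u` are laid end to end, the block of u starting at `prefix y u`. Each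
-- position N has a block u and an offset l; the wrap-around rule in `combine` reads its colours off
-- this layout.
locate : ∀ {n} (y : Fin n → ℕ) N → N < sum y → ∃₂ λ u l → l < y u × prefix y u + l ≡ N
locate {suc n} y N N<Σ with N <? y zero
... | yes N<y = zero , N , N<y , refl
... | no N≮y with locate (y ∘ suc) (N ∸ y zero)
                   (+-cancelˡ-< (y zero) _ _ (subst (_< _) (sym (m+[n∸m]≡n (≮⇒≥ N≮y))) N<Σ))
...   | u , l , l<y , eq = suc u , l , l<y ,
        trans (+-assoc (y zero) _ l) (trans (cong (y zero +_) eq) (m+[n∸m]≡n (≮⇒≥ N≮y)))

-- Kinds of branches and the counting bounds at a single vertex.

data Kind : Set where
  null loose tight double : Kind

_≟ᵏ_ : (k l : Kind) → Dec (k ≡ l)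
null   ≟ᵏ null   = yes refl
null   ≟ᵏ loose  = no λ ()
null   ≟ᵏ tight  = no λ ()
null   ≟ᵏ double = no λ ()
loose  ≟ᵏ null   = no λ ()
loose  ≟ᵏ loose  = yes refl
loose  ≟ᵏ tight  = no λ ()
loose  ≟ᵏ double = no λ ()
tight  ≟ᵏ null   = no λ ()
tight  ≟ᵏ loose  = no λ ()
tight  ≟ᵏ tight  = yes refl
tight  ≟ᵏ double = no λ ()
double ≟ᵏ null   = no λ ()
double ≟ᵏ loose  = no λ ()
double ≟ᵏ tight  = no λ ()
double ≟ᵏ double = yes refl

surplus : Kind → ℕ → ℕ → ℕ
surplus null   a c = 0
surplus loose  a c = a
surplus tight  a c = c
surplus double a c = a + c


-- A bound by a minimum is a bound by each argument. In the second hypothesis b stands on the left,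
-- which keeps truncated subtraction out of the estimates that supply it.
≤-min-budget : ∀ {t A b X} Y → b ≤ t → X ≤ t + (Y + A) → X + b ≤ t + (Y + t) →
  X ≤ t + (Y + A ⊓ (t ∸ b))
≤-min-budget {t} {A} {b} {X} Y b≤t X≤ X+b≤ with ≤-total A (t ∸ b)
... | inj₁ A≤ = subst (λ y → X ≤ t + (Y + y)) (sym (m≤n⇒m⊓n≡m A≤)) X≤
... | inj₂ ≤A = subst (λ y → X ≤ t + (Y + y)) (sym (m≥n⇒m⊓n≡n ≤A))
  (cancel-≤ b X+b≤ (+-comm X b)
    (trans (cong (λ y → t + (Y + y)) (sym (m∸n+n≡m b≤t))) (eq t Y (t ∸ b) b)))
  where
  eq : ∀ t Y s b → t + (Y + (s + b)) ≡ b + (t + (Y + s))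
  eq = solve-∀

-- A vertex v of multiplicity m receives a u from each child u and b from the parent w.
-- It can send m + Q to w and m + q u to u; c u stands for min (a u) (t − (m + q u)).
module Budget {n} (t m Q M b : ℕ) (w : Fin n) (a c q : Fin n → ℕ)
  (1≤t : 1 ≤ t) (b≤t : b ≤ t) (a≤t : ∀ u → a u ≤ t) (aw≡0 : a w ≡ 0)
  (maxQ : sum (cap (suc Q) a) ≤ suc (Q + Q))
  (maxM : sum (cap (suc M) (a [ w ]≔ b)) ≤ suc (M + M)) (m+M≤t : m + M ≤ t)
  (maxq : ∀ u → sum (cap (suc (q u)) (a [ w ]≔ b [ u ]≔ 0)) ≤ suc (q u + q u))
  (m≤t : m ≤ t) (m+Q≤t : m + Q ≤ t)
  (c≤a : ∀ u → c u ≤ a u) (c≤t : ∀ u → 1 ≤ c u → c u + (m + q u) ≤ t)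
  where

  α : Fin n → ℕ
  α = a [ w ]≔ b

  A : ℕ
  A = m + Q

  α≤t : ∀ u → α u ≤ t
  α≤t = update-elim (λ _ y → y ≤ t) a w b b≤t (λ u _ → a≤t u)

  -- Since `a w` is zero, z vanishes at the parent, and overwriting that entry with b loses nothing.
  sum-α : ∀ (z : Fin n → ℕ) → (∀ u → z u ≤ a u) → sum z + b ≤ sum (z [ w ]≔ b)
  sum-α z z≤a = begin
    sum z + b                                ≤⟨ +-monoˡ-≤ b (sum-mono erase) ⟩
    sum (z [ w ]≔ b [ w ]≔ 0) + b             ≡⟨ +-comm _ b ⟩
    b + sum (z [ w ]≔ b [ w ]≔ 0)             ≡⟨ cong (_+ sum (z [ w ]≔ b [ w ]≔ 0)) (sym (update-at z w b)) ⟩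
    (z [ w ]≔ b) w + sum (z [ w ]≔ b [ w ]≔ 0) ≡⟨ sym (sum-split (z [ w ]≔ b) w) ⟩
    sum (z [ w ]≔ b)                         ∎
    where
    open ≤-Reasoning
    erase : ∀ u → z u ≤ (z [ w ]≔ b [ w ]≔ 0) u
    erase = update-elim (λ u y → z u ≤ y) (z [ w ]≔ b) w 0 (subst (z w ≤_) aw≡0 (z≤a w))
              (λ u u≢w → ≤-reflexive (sym (update-off z w b u≢w)))

  m+c≤t : ∀ u → m + c u ≤ t
  m+c≤t u with 1 ≤? c u
  ... | yes 1≤c = ≤-trans (subst (_≤ c u + (m + q u)) (+-comm (c u) m) (+-monoʳ-≤ (c u) (m≤m+n m (q u)))) (c≤t u 1≤c)
  ... | no c<1 = subst (λ x → m + x ≤ t) (sym (n<1⇒n≡0 (≰⇒> c<1))) (subst (_≤ t) (sym (+-identityʳ m)) m≤t)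

  sum-a : sum a ≤ suc (Q + Q) ⊎ sum a ≤ t + Q
  sum-a = dichotomy a t Q a≤t maxQ

  sum-a+b : sum a + b ≤ suc (M + M) ⊎ sum a + b ≤ t + M
  sum-a+b with dichotomy α t M α≤t maxM
  ... | inj₁ h = inj₁ (≤-trans (sum-α a (λ _ → ≤-refl)) h)
  ... | inj₂ h = inj₂ (≤-trans (sum-α a (λ _ → ≤-refl)) h)

  weak-out : m + sum a ≤ t + (A + A)
  weak-out with sum-a
  ... | inj₁ h = cancel-≤ 1 (+-mono-≤ (+-mono-≤ h 1≤t) (m≤m+n m m)) (l m (sum a)) (r t m Q)
    where
    l : ∀ m s → s + 1 + m ≡ 1 + (m + s)
    l = solve-∀
    r : ∀ t m Q → suc (Q + Q) + t + (m + m) ≡ 1 + (t + ((m + Q) + (m + Q)))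
    r = solve-∀
  ... | inj₂ h = ≤-trans (+-monoʳ-≤ m h)
    (≤-trans (≤-reflexive (eq m t Q)) (+-monoʳ-≤ t (m≤m+n A A)))
    where
    eq : ∀ m t Q → m + (t + Q) ≡ t + (m + Q)
    eq = solve-∀

  m+M+M≤ : m + (t + M) ≤ t + t
  m+M+M≤ = ≤-trans (≤-reflexive (eq m t M)) (+-monoʳ-≤ t m+M≤t)
    where
    eq : ∀ m t M → m + (t + M) ≡ t + (m + M)
    eq = solve-∀

  M≤t : M ≤ t
  M≤t = ≤-trans (m≤n+m M m) m+M≤t

  A<1⇒sum-a≤t : ¬ 1 ≤ A → sum a ≤ t
  A<1⇒sum-a≤t ¬1≤A with sum-a
  ... | inj₁ h = ≤-trans h (subst (λ x → suc (x + x) ≤ t) (sym Q≡0) 1≤t)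
    where
    Q≡0 : Q ≡ 0
    Q≡0 = n<1⇒n≡0 (≤-<-trans (m≤n+m Q m) (≰⇒> ¬1≤A))
  ... | inj₂ h = ≤-trans h (≤-reflexive (trans (cong (t +_) Q≡0) (+-identityʳ t)))
    where
    Q≡0 : Q ≡ 0
    Q≡0 = n<1⇒n≡0 (≤-<-trans (m≤n+m Q m) (≰⇒> ¬1≤A))

  weak-in : m + sum a + b ≤ t + (A + t)
  weak-in with sum-a+b
  ... | inj₂ h = ≤-trans (≤-reflexive (+-assoc m (sum a) b))
    (≤-trans (+-monoʳ-≤ m h) (≤-trans m+M+M≤ (+-monoʳ-≤ t (m≤n+m t A))))
  -- The odd unit of `suc (M + M)` is paid for by A when A is positive. Otherwise m and Q are zero,
  -- and `sum a` and b are each at most t.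
  ... | inj₁ h with 1 ≤? A
  ...   | yes 1≤A = cancel-≤ (M + M + 1) (+-mono-≤ (+-mono-≤ h (+-mono-≤ m+M≤t M≤t)) 1≤A)
                      (l (sum a) b m M) (r M t A)
    where
    l : ∀ s b m M → s + b + (m + M + M) + 1 ≡ (M + M + 1) + (m + s + b)
    l = solve-∀
    r : ∀ M t A → suc (M + M) + (t + t) + A ≡ (M + M + 1) + (t + (A + t))
    r = solve-∀
  ...   | no ¬1≤A = subst (_≤ t + (A + t)) (sym (+-assoc m (sum a) b))
    (≤-trans (+-mono-≤ (m≤m+n m Q) (+-mono-≤ (A<1⇒sum-a≤t ¬1≤A) b≤t)) (≤-reflexive (eq A t)))
    where
    eq : ∀ A t → A + (t + t) ≡ t + (A + t)
    eq = solve-∀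

  weak : m + sum a ≤ t + (A + A ⊓ (t ∸ b))
  weak = ≤-min-budget A b≤t weak-out weak-in

  -- By `sum-a` the sum is at most t + Q, except when 2Q + 1 exceeds t + Q; then t ≤ Q, and the
  -- assumed bound 2t is at most t + Q.
  out-bound : (z : Fin n → ℕ) → (∀ u → z u ≤ a u) → sum z ≤ t + t → m + sum z ≤ t + A
  out-bound z z≤a h = ≤-trans (+-monoʳ-≤ m sum≤) (≤-reflexive (eq m t Q))
    where
    eq : ∀ m t Q → m + (t + Q) ≡ t + (m + Q)
    eq = solve-∀
    sum≤ : sum z ≤ t + Q
    sum≤ with t ≤? Q | sum-a
    ... | yes t≤Q | _ = ≤-trans h (+-monoʳ-≤ t t≤Q)
    ... | no _    | inj₂ h′ = ≤-trans (sum-mono z≤a) h′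
    ... | no t≰Q  | inj₁ h′ = ≤-trans (sum-mono z≤a) (≤-trans h′ (+-monoˡ-≤ Q (≰⇒> t≰Q)))

  -- The messages into v other than that of i sum to at most 2q + 1 or t + q, where q is `q i`.
  -- Adding m and `c i` and using `c i` + m + q ≤ t gives 2t in both cases; in the first, `c i` ≥ 1
  -- absorbs the odd unit.
  in-bound : (z : Fin n → ℕ) → (∀ u → z u ≤ a u) → ∀ i → 1 ≤ c i → z i ≤ c i →
    m + sum z + b ≤ t + t
  in-bound z z≤a i 1≤c zi≤c = subst (_≤ t + t) (sym (+-assoc m (sum z) b)) bound
    where
    i≢w : i ≢ w
    i≢w refl = contradiction (≤-trans 1≤c (subst (c w ≤_) aw≡0 (c≤a w))) λ ()

    z≤α : ∀ u → (z [ w ]≔ b) u ≤ α u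
    z≤α u with u ≟ w
    ... | yes refl = ≤-reflexive (trans (update-at z w b) (sym (update-at a w b)))
    ... | no u≢w   = subst₂ _≤_ (sym (update-off z w b u≢w)) (sym (update-off a w b u≢w)) (z≤a u)

    split : ∀ u → (z [ w ]≔ b) u ≤ (α [ i ]≔ 0) u + single i (c i) u
    split u with u ≟ i
    ... | yes refl = subst₂ _≤_ (sym (update-off z w b i≢w))
                       (sym (cong₂ _+_ (update-at α i 0) (single-at i (c i)))) zi≤c
    ... | no u≢i   = ≤-trans (z≤α u) (≤-trans (≤-reflexive (sym (update-off α i 0 u≢i))) (m≤m+n _ _))

    sum-z : sum z + b ≤ sum (α [ i ]≔ 0) + c i
    sum-z = ≤-trans (sum-α z z≤a) (sum-≤-single i (c i) split)

    eq₁ : ∀ m q c → m + (suc (q + q) + c) ≡ (c + (m + q)) + (1 + q)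
    eq₁ = solve-∀
    eq₂ : ∀ m t q c → m + (t + q + c) ≡ t + (c + (m + q))
    eq₂ = solve-∀

    bound : m + (sum z + b) ≤ t + t
    bound with dichotomy (α [ i ]≔ 0) t (q i) (update-elim (λ _ y → y ≤ t) α i 0 z≤n (λ u _ → α≤t u)) (maxq i)
    ... | inj₁ h = begin
      m + (sum z + b)                    ≤⟨ +-monoʳ-≤ m (≤-trans sum-z (+-monoˡ-≤ (c i) h)) ⟩
      m + (suc (q i + q i) + c i)        ≡⟨ eq₁ m (q i) (c i) ⟩
      (c i + (m + q i)) + (1 + q i)      ≤⟨ +-mono-≤ (c≤t i 1≤c) (+-mono-≤ 1≤c (m≤n+m (q i) m)) ⟩
      t + (c i + (m + q i))              ≤⟨ +-monoʳ-≤ t (c≤t i 1≤c) ⟩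
      t + t                              ∎
      where open ≤-Reasoning
    ... | inj₂ h = begin
      m + (sum z + b)                    ≤⟨ +-monoʳ-≤ m (≤-trans sum-z (+-monoˡ-≤ (c i) h)) ⟩
      m + (t + q i + c i)                ≡⟨ eq₂ m t (q i) (c i) ⟩
      t + (c i + (m + q i))              ≤⟨ +-monoʳ-≤ t (c≤t i 1≤c) ⟩
      t + t                              ∎
      where open ≤-Reasoning

  out-in-bound : (z : Fin n → ℕ) → (∀ u → z u ≤ a u) → m + sum z + b ≤ t + t →
    m + sum z ≤ t + A ⊓ (t ∸ b)
  out-in-bound z z≤a h = ≤-min-budget 0 b≤t
    (out-bound z z≤a (≤-trans (≤-trans (m≤n+m (sum z) m) (m≤m+n _ b)) h)) h

  module _ (κ : Fin n → Kind) where

    e : Fin n → ℕ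
    e u = surplus (κ u) (a u) (c u)

    -- The children whose surplus includes a positive `c u`: these serve as witnesses i for
    -- `in-bound`.
    Tied : Fin n → Set
    Tied u = κ u ≢ null × κ u ≢ loose × 1 ≤ c u

    tied? : ∀ u → Dec (Tied u)
    tied? u = ¬? (κ u ≟ᵏ null) ×-dec ¬? (κ u ≟ᵏ loose) ×-dec (1 ≤? c u)

    c<1⇒c≡0 : ∀ {u} → ¬ 1 ≤ c u → c u ≡ 0
    c<1⇒c≡0 ¬1≤c = n<1⇒n≡0 (≰⇒> ¬1≤c)

    e≤a : ∀ u → (κ u ≡ double → c u ≡ 0) → e u ≤ a u
    e≤a u h with κ u
    ... | null   = z≤n
    ... | loose  = ≤-refl
    ... | tight  = c≤a u
    ... | double = ≤-reflexive (trans (cong (a u +_) (h refl)) (+-identityʳ (a u)))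

    e-untied : ∀ u → ¬ Tied u → κ u ≢ loose → κ u ≢ double → e u ≡ 0
    e-untied u ¬tied ¬loose ¬double with κ u
    ... | null   = refl
    ... | loose  = contradiction refl ¬loose
    ... | tight  = c<1⇒c≡0 λ 1≤c → ¬tied ((λ ()) , (λ ()) , 1≤c)
    ... | double = contradiction refl ¬double

    e-tied : ∀ u → Tied u → κ u ≢ double → e u ≡ c u
    e-tied u (¬null , ¬loose , _) ¬double with κ u
    ... | null   = contradiction refl ¬null
    ... | loose  = contradiction refl ¬loose
    ... | tight  = refl
    ... | double = contradiction refl ¬double

    e-null : ∀ u → κ u ≡ null → e u ≡ 0
    e-null u eq rewrite eq = refl

    second : Kind → ℕ → ℕ
    second double c = c
    second _      c = 0

    -- Each double child contributes once to either summand; the two summands swap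
    -- the roles of aᵢ and cᵢ so that each of them contains a witness for in-bound.
    any-doubles : m + sum e ≤ t + t + (A + A ⊓ (t ∸ b))
    any-doubles with any? (λ i → (κ i ≟ᵏ double) ×-dec (1 ≤? c i))
    ... | no none = ≤-trans (+-monoʳ-≤ m (sum-mono λ u → e≤a u λ d → c<1⇒c≡0 λ 1≤c → none (u , d , 1≤c)))
                      (≤-trans weak (+-monoˡ-≤ _ (m≤m+n t t)))
    ... | yes (i , di , 1≤ci) = begin
      m + sum e                                ≤⟨ +-monoʳ-≤ m e≤ ⟩
      m + (sum z₁ + sum z₂)                    ≡⟨ sym (+-assoc m (sum z₁) (sum z₂)) ⟩
      (m + sum z₁) + sum z₂                    ≤⟨ +-mono-≤ first second-bound ⟩
      (t + A ⊓ (t ∸ b)) + (t + A)              ≡⟨ eq t (A ⊓ (t ∸ b)) A ⟩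
      t + t + (A + A ⊓ (t ∸ b))                ∎
      where
      open ≤-Reasoning
      eq : ∀ t x A → (t + x) + (t + A) ≡ t + t + (A + x)
      eq = solve-∀
      s z₁ z₂ : Fin n → ℕ
      s u = second (κ u) (c u)
      z₁ = a [ i ]≔ c i
      z₂ = s [ i ]≔ a i

      s≤c : ∀ u → s u ≤ c u
      s≤c u with κ u
      ... | null   = z≤n
      ... | loose  = z≤n
      ... | tight  = z≤n
      ... | double = ≤-refl

      e≤a+s : ∀ u → e u ≤ a u + s u
      e≤a+s u with κ u
      ... | null   = z≤n
      ... | loose  = m≤m+n _ _
      ... | tight  = ≤-trans (c≤a u) (m≤m+n _ _)
      ... | double = ≤-refl

      z≤ : ∀ u → e u ≤ z₁ u + z₂ u
      z≤ u with u ≟ i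
      ... | yes refl = subst₂ _≤_ (sym (cong (λ k → surplus k (a i) (c i)) di))
                         (sym (cong₂ _+_ (update-at a i (c i)) (update-at s i (a i))))
                         (≤-reflexive (+-comm (a i) (c i)))
      ... | no u≢i   = subst (e u ≤_) (sym (cong₂ _+_ (update-off a i (c i) u≢i) (update-off s i (a i) u≢i))) (e≤a+s u)

      e≤ : sum e ≤ sum z₁ + sum z₂
      e≤ = ≤-trans (sum-mono z≤) (≤-reflexive (∑-distrib-+ z₁ z₂))

      z₁≤a : ∀ u → z₁ u ≤ a u
      z₁≤a = update-elim (λ u y → y ≤ a u) a i (c i) (c≤a i) (λ _ _ → ≤-refl)
      z₂≤a : ∀ u → z₂ u ≤ a u
      z₂≤a = update-elim (λ u y → y ≤ a u) s i (a i) ≤-refl (λ u _ → ≤-trans (s≤c u) (c≤a u))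

      first : m + sum z₁ ≤ t + A ⊓ (t ∸ b)
      first = out-in-bound z₁ z₁≤a (in-bound z₁ z₁≤a i 1≤ci (≤-reflexive (update-at a i (c i))))

      second-bound : sum z₂ ≤ t + A
      -- Since `z₂ i` is `a i`, a witness for `z₂` has to be another double child; without one, `z₂`
      -- is supported at i alone.
      second-bound with any? (λ j → ¬? (j ≟ i) ×-dec (κ j ≟ᵏ double) ×-dec (1 ≤? c j))
      ... | yes (j , j≢i , dj , 1≤cj) = ≤-trans (m≤n+m (sum z₂) m) (out-bound z₂ z₂≤a
              (≤-trans (≤-trans (m≤n+m (sum z₂) m) (m≤m+n _ b)) (in-bound z₂ z₂≤a j 1≤cj
                (≤-trans (≤-reflexive (update-off s i (a i) j≢i)) (s≤c j)))))
      ... | no none = ≤-trans (sum-mono vanish) (≤-trans (≤-reflexive (sum-single i (a i)))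
                        (≤-trans (a≤t i) (m≤m+n t A)))
        where
        s-off : ∀ u → u ≢ i → s u ≡ 0
        s-off u u≢i with κ u in eqk
        ... | null   = refl
        ... | loose  = refl
        ... | tight  = refl
        ... | double = c<1⇒c≡0 λ 1≤c → none (u , u≢i , eqk , 1≤c)
        vanish : ∀ u → z₂ u ≤ single i (a i) u
        vanish = update-elim (λ u y → y ≤ single i (a i) u) s i (a i)
          (≤-reflexive (sym (single-at i (a i)))) (λ u u≢i → subst (_≤ _) (sym (s-off u u≢i)) z≤n)

    -- The surplus of i splits into `a i`, which is at most t, and `c i`, which stays with the other
    -- children; any tied child, possibly i itself, is then a witness for `in-bound`. With no tied
    -- child every surplus is at most `a u`, and `weak` together with A ≤ t suffices.
    one-double : ∀ i → κ i ≡ double → (∀ u → u ≢ i → κ u ≢ double) → m + sum e ≤ t + t + A ⊓ (t ∸ b)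
    one-double i di others with any? tied?
    ... | no none = ≤-trans (+-monoʳ-≤ m (sum-mono λ u → e≤a u λ d → c<1⇒c≡0 λ 1≤c →
                       none (u , subst (_≢ null) (sym d) (λ ()) , subst (_≢ loose) (sym d) (λ ()) , 1≤c)))
                      (≤-trans weak (≤-trans (+-monoʳ-≤ t (+-monoˡ-≤ _ m+Q≤t)) (≤-reflexive (sym (+-assoc t t _)))))
    ... | yes (j , tied@(_ , _ , 1≤cj)) = begin
      m + sum e                      ≤⟨ +-monoʳ-≤ m (sum-≤-single i (a i) e≤) ⟩
      m + (sum z + a i)              ≡⟨ sym (+-assoc m (sum z) (a i)) ⟩
      (m + sum z) + a i              ≤⟨ +-mono-≤ (out-in-bound z z≤a (in-bound z z≤a j 1≤cj zj≤)) (a≤t i) ⟩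
      t + A ⊓ (t ∸ b) + t            ≡⟨ eq t (A ⊓ (t ∸ b)) ⟩
      t + t + A ⊓ (t ∸ b)            ∎
      where
      open ≤-Reasoning
      eq : ∀ t x → t + x + t ≡ t + t + x
      eq = solve-∀
      z : Fin n → ℕ
      z = e [ i ]≔ c i
      z≤a : ∀ u → z u ≤ a u
      z≤a = update-elim (λ u y → y ≤ a u) e i (c i) (c≤a i)
              (λ u u≢i → e≤a u λ d → contradiction d (others u u≢i))
      e≤ : ∀ u → e u ≤ z u + single i (a i) u
      e≤ u with u ≟ i
      ... | yes refl = subst₂ _≤_ (sym (cong (λ k → surplus k (a i) (c i)) di))
                         (sym (cong₂ _+_ (update-at e i (c i)) (single-at i (a i)))) (≤-reflexive (+-comm (a i) (c i)))
      ... | no u≢i   = ≤-trans (≤-reflexive (sym (update-off e i (c i) u≢i))) (m≤m+n _ _)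
      zj≤ : z j ≤ c j
      zj≤ with j ≟ i
      ... | yes refl = ≤-reflexive (update-at e i (c i))
      ... | no j≢i   = ≤-reflexive (trans (update-off e i (c i) j≢i) (e-tied j tied (others j j≢i)))

    e-only : ∀ i → (∀ u → u ≢ i → κ u ≡ null) → sum e ≤ e i
    e-only i others = ≤-trans (sum-mono bound) (≤-reflexive (sum-single i (e i)))
      where
      bound : ∀ u → e u ≤ single i (e i) u
      bound u with u ≟ i
      ... | yes refl = ≤-reflexive (sym (single-at i (e i)))
      ... | no u≢i   = subst (_≤ single i (e i) u) (sym (e-null u (others u u≢i))) z≤n

    only-double : ∀ i → κ i ≡ double → (∀ u → u ≢ i → κ u ≡ null) → m + sum e ≤ t + t
    only-double i di others = begin
      m + sum e          ≤⟨ +-monoʳ-≤ m (e-only i others) ⟩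
      m + e i            ≡⟨ cong (λ k → m + surplus k (a i) (c i)) di ⟩
      m + (a i + c i)    ≡⟨ eq m (a i) (c i) ⟩
      a i + (m + c i)    ≤⟨ +-mono-≤ (a≤t i) (m+c≤t i) ⟩
      t + t              ∎
      where
      open ≤-Reasoning
      eq : ∀ m a c → m + (a + c) ≡ a + (m + c)
      eq = solve-∀

    only-tight : ∀ i → κ i ≡ tight → (∀ u → u ≢ i → κ u ≡ null) → m + sum e ≤ t
    only-tight i ti others = ≤-trans (+-monoʳ-≤ m (e-only i others))
      (subst (λ k → m + surplus k (a i) (c i) ≤ t) (sym ti) (m+c≤t i))

    all-null : (∀ u → κ u ≡ null) → m + sum e ≤ A
    all-null nulls = +-monoʳ-≤ m (subst (_≤ Q) (sym (sum-zero λ u → e-null u (nulls u))) z≤n)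

    module _ (¬double : ∀ u → κ u ≢ double) where

      e≤a′ : ∀ u → e u ≤ a u
      e≤a′ u = e≤a u λ d → contradiction d (¬double u)

      no-double : m + sum e ≤ t + (A + A ⊓ (t ∸ b))
      no-double = ≤-trans (+-monoʳ-≤ m (sum-mono e≤a′)) weak

      tied-bound : ∀ j → Tied j → m + sum e + b ≤ t + t
      tied-bound j tied@(_ , _ , 1≤c) = in-bound e e≤a′ j 1≤c (≤-reflexive (e-tied j tied (¬double j)))

      -- It is enough to reach 2t and apply `out-bound`. A tied child gives this through `in-bound`;
      -- otherwise only i and j contribute, each at most t.
      two-loose : ∀ i j → (∀ u → u ≢ i → u ≢ j → κ u ≢ loose) → m + sum e ≤ t + A
      two-loose i j others with any? tied?
      ... | yes (k , tied) = out-bound e e≤a′ (≤-trans (≤-trans (m≤n+m (sum e) m) (m≤m+n _ b)) (tied-bound k tied))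
      ... | no none = out-bound e e≤a′ (≤-trans (sum-≤-single j (a j) bound)
                        (+-mono-≤ (≤-trans (≤-reflexive (sum-single i (a i))) (a≤t i)) (a≤t j)))
        where
        bound : ∀ u → e u ≤ single i (a i) u + single j (a j) u
        bound u with u ≟ i | u ≟ j
        ... | yes refl | _ = ≤-trans (e≤a′ i) (≤-trans (≤-reflexive (sym (single-at i (a i)))) (m≤m+n _ _))
        ... | no _ | yes refl = ≤-trans (e≤a′ j) (≤-trans (≤-reflexive (sym (single-at j (a j)))) (m≤n+m _ _))
        ... | no u≢i | no u≢j = subst (_≤ single i (a i) u + single j (a j) u)
              (sym (e-untied u (λ tied → none (u , tied)) (others u u≢i u≢j) (¬double u))) z≤n

      -- Without a tied child only i contributes. If m is zero, the contribution of i and b are each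
      -- at most t; if m is positive, the limit M on all messages into v applies, and m absorbs the
      -- odd unit of 2M + 1.
      one-loose : ∀ i → (∀ u → u ≢ i → κ u ≢ loose) → m + sum e ≤ t + A ⊓ (t ∸ b)
      one-loose i others with any? tied?
      ... | yes (k , tied) = out-in-bound e e≤a′ (tied-bound k tied)
      ... | no none = out-in-bound e e≤a′ (≤-trans (≤-reflexive (+-assoc m (sum e) b)) total)
        where
        bound : ∀ u → e u ≤ single i (a i) u
        bound u with u ≟ i
        ... | yes refl = ≤-trans (e≤a′ i) (≤-reflexive (sym (single-at i (a i))))
        ... | no u≢i   = subst (_≤ single i (a i) u)
              (sym (e-untied u (λ tied → none (u , tied)) (others u u≢i) (¬double u))) z≤n
        sum-e : sum e ≤ a i
        sum-e = ≤-trans (sum-mono bound) (≤-reflexive (sum-single i (a i)))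
        total : m + (sum e + b) ≤ t + t
        total with 1 ≤? m | sum-a+b
        ... | no m<1  | _ = subst (λ x → x + (sum e + b) ≤ t + t) (sym (n<1⇒n≡0 (≰⇒> m<1)))
                              (+-mono-≤ (≤-trans sum-e (a≤t i)) b≤t)
        ... | yes _   | inj₂ h = ≤-trans (+-monoʳ-≤ m (≤-trans (+-monoˡ-≤ b (sum-mono e≤a′)) h)) m+M+M≤
        ... | yes 1≤m | inj₁ h = begin
          m + (sum e + b)         ≤⟨ +-monoʳ-≤ m (≤-trans (+-monoˡ-≤ b (sum-mono e≤a′)) h) ⟩
          m + suc (M + M)         ≡⟨ eq m M ⟩
          (m + M) + (1 + M)       ≤⟨ +-mono-≤ m+M≤t (≤-trans (+-monoˡ-≤ M 1≤m) m+M≤t) ⟩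
          t + t                   ∎
          where
          open ≤-Reasoning
          eq : ∀ m M → m + suc (M + M) ≡ (m + M) + (1 + M)
          eq = solve-∀

-- Lists without repetition.

lookup-injective : ∀ {A : Set} {xs : List A} → Unique xs → ∀ i j → lookup xs i ≡ lookup xs j → i ≡ j
lookup-injective (x∉ ∷ u) zero    zero    eq = refl
lookup-injective (x∉ ∷ u) zero    (suc j) eq = contradiction eq (All.lookup x∉ (∈-lookup j))
lookup-injective (x∉ ∷ u) (suc i) zero    eq = contradiction (sym eq) (All.lookup x∉ (∈-lookup i))
lookup-injective (x∉ ∷ u) (suc i) (suc j) eq = cong suc (lookup-injective u i j eq)

unique-⊆-length : ∀ {A : Set} {xs ys : List A} → Unique xs → (∀ {x} → x ∈ xs → x ∈ ys) → length xs ≤ length ys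
unique-⊆-length {xs = xs} {ys} u xs⊆ys = injective⇒≤ {f = λ i → index (xs⊆ys (∈-lookup i))} λ {i} {j} eq →
  lookup-injective u i j (trans (lookup-index (xs⊆ys (∈-lookup i)))
    (trans (cong (lookup ys) eq) (sym (lookup-index (xs⊆ys (∈-lookup j))))))

unique-length : ∀ {n} {xs : List (Fin n)} → Unique xs → length xs ≤ n
unique-length u = injective⇒≤ (λ {i} {j} → lookup-injective u i j)

unique-prefix : ∀ {A : Set} (ps : List A) {qs} → Unique (ps ++ qs) → Unique ps
unique-prefix []       u        = []
unique-prefix (p ∷ ps) (p∉ ∷ u) = All.++⁻ˡ ps p∉ ∷ unique-prefix ps u

linked-prefix : ∀ {A : Set} {R : A → A → Set} (ps : List A) {x qs} → Linked R (ps ++ x ∷ qs) → Linked R (ps ++ [ x ])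
linked-prefix []           l       = [-]
linked-prefix (p ∷ [])     (r ∷ l) = r ∷ [-]
linked-prefix (p ∷ q ∷ ps) (r ∷ l) = r ∷ linked-prefix (q ∷ ps) l

length-concat-tabulate : ∀ {A : Set} {n} (f : Fin n → List A) → length (concat (tabulate f)) ≡ sum (length ∘ f)
length-concat-tabulate {n = zero}  f = refl
length-concat-tabulate {n = suc n} f =
  trans (length-++ (f zero)) (cong (length (f zero) +_) (length-concat-tabulate (f ∘ suc)))

does-true : ∀ {A : Set} (A? : Dec A) → does A? ≡ true → A
does-true (yes a) _ = a

-- Branches, generation and convex hulls in a tree.

module Tree {n} (G : Graph n) where
  open Graph G using (adj; adj-sym; adj-irr)

  infix 4 _~_
  _~_ : Fin n → Fin n → Set
  _~_ = Adj G

  ~-sym : ∀ {u v} → u ~ v → v ~ u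
  ~-sym {u} {v} = subst T (adj-sym u v)

  ~⇒≢ : ∀ {u v} → u ~ v → u ≢ v
  ~⇒≢ {u} u~u refl = subst T (adj-irr u) u~u

  _~?_ : ∀ u v → Dec (u ~ v)
  u ~? v = T? (adj u v)

  -- The branch of v on the side away from its neighbour w; Br v v is the component of v.
  data Br (v w : Fin n) : Fin n → Set where
    here : Br v w v
    step : ∀ {u x} → u ~ v → u ≢ w → Br u v x → Br v w x

  -- Accessibility of the descent into branches. It carries the recursions that decide `Gen` and
  -- `Br` and the induction that summarises branches.
  data Wf (v w : Fin n) : Set where
    node : (∀ u → u ~ v → u ≢ w → Wf u v) → Wf v w

  -- v is generated by P within the branch Br v w.
  data Gen (P : Fin n → Set) (v w : Fin n) : Set where
    base : P v → Gen P v w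
    join : ∀ {x y} → x ≢ y → x ~ v → y ~ v → x ≢ w → y ≢ w → Gen P x v → Gen P y v → Gen P v w

  -- Walks that never turn back.
  data NB : List (Fin n) → Set where
    edge : ∀ {x y} → x ~ y → NB (x ∷ y ∷ [])
    cons : ∀ {x y z l} → x ~ y → x ≢ z → NB (y ∷ z ∷ l) → NB (x ∷ y ∷ z ∷ l)

  Br-widen : ∀ {v w x} → Br v w x → Br v v x
  Br-widen here            = here
  Br-widen (step u~v _ br) = step u~v (~⇒≢ u~v) br

  -- If the path obtained from the next vertex u starts by returning to v, this detour is cut out.
  walk⇒Br : ∀ {v x} → Walk G v x → Br v v x
  walk⇒Br nil = here
  walk⇒Br {v} (cons v~u walk) with walk⇒Br walk
  ... | here = step (~-sym v~u) (~⇒≢ (~-sym v~u)) here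
  ... | step {u′} u′~u u′≢u br with u′ ≟ v
  ...   | yes refl = Br-widen br
  ...   | no u′≢v  = step (~-sym v~u) (~⇒≢ (~-sym v~u)) (step u′~u u′≢v br)

  Gen-widen : ∀ {P v w} → Gen P v w → Gen P v v
  Gen-widen (base p) = base p
  Gen-widen (join x≢y x~v y~v _ _ gx gy) = join x≢y x~v y~v (~⇒≢ x~v) (~⇒≢ y~v) gx gy

  Gen-mono : ∀ {P Q v w} → (∀ {x} → Br v w x → P x → Q x) → Gen P v w → Gen Q v w
  Gen-mono P⊆Q (base p) = base (P⊆Q here p)
  Gen-mono P⊆Q (join x≢y x~v y~v x≢w y≢w gx gy) = join x≢y x~v y~v x≢w y≢w
    (Gen-mono (P⊆Q ∘ step x~v x≢w) gx) (Gen-mono (P⊆Q ∘ step y~v y≢w) gy)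

  Gen⇒hull : ∀ {P v w} → Gen P v w → InHull G P v
  Gen⇒hull (base p) U convex P⊆U = P⊆U _ p
  Gen⇒hull {v = v} (join {x} {y} x≢y x~v y~v _ _ gx gy) U convex P⊆U with v ∈ˢ? U
  ... | yes v∈U = v∈U
  ... | no v∉U  = contradiction
    (convex v v∉U x y (Gen⇒hull gx U convex P⊆U) (Gen⇒hull gy U convex P⊆U) (~-sym x~v) (~-sym y~v)) x≢y

  Gen? : ∀ {P} → (∀ x → Dec (P x)) → ∀ {v w} → Wf v w → Dec (Gen P v w)
  Gen? {P} P? {v} {w} (node sub) = map′ to from (P? v ⊎-dec any? λ x → any? λ y → source? x ×-dec source? y ×-dec ¬? (x ≟ y))
    where
    Source : Fin n → Set
    Source x = Σ (x ~ v) λ _ → Σ (x ≢ w) λ _ → Gen P x v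
    source? : ∀ x → Dec (Source x)
    source? x with x ~? v | x ≟ w
    ... | no ¬x~v | _        = no (¬x~v ∘ proj₁)
    ... | yes _   | yes x≡w  = no λ (_ , x≢w , _) → x≢w x≡w
    ... | yes x~v | no x≢w   = map′ (λ g → x~v , x≢w , g) (proj₂ ∘ proj₂) (Gen? P? (sub x x~v x≢w))
    to : P v ⊎ (∃₂ λ x y → Source x × Source y × x ≢ y) → Gen P v w
    to (inj₁ p) = base p
    to (inj₂ (x , y , (x~v , x≢w , gx) , (y~v , y≢w , gy) , x≢y)) = join x≢y x~v y~v x≢w y≢w gx gy
    from : Gen P v w → P v ⊎ (∃₂ λ x y → Source x × Source y × x ≢ y)
    from (base p) = inj₁ p
    from (join {x} {y} x≢y x~v y~v x≢w y≢w gx gy) = inj₂ (x , y , (x~v , x≢w , gx) , (y~v , y≢w , gy) , x≢y)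

  -- If v is one of the two neighbours that generate x, its own derivation already lies in the
  -- branch away from x; if not, the derivation of x avoids the direction of v.
  Gen-turn : ∀ {P x v} → Gen P x x → x ~ v → Gen P x v ⊎ Gen P v x
  Gen-turn (base p) x~v = inj₁ (base p)
  Gen-turn {v = v} (join {y} {z} y≢z y~x z~x _ _ gy gz) x~v with y ≟ v | z ≟ v
  ... | yes refl | _        = inj₂ gy
  ... | no _     | yes refl = inj₂ gz
  ... | no y≢v   | no z≢v   = inj₁ (join y≢z y~x z~x y≢v z≢v gy gz)

  module _ (wf : ∀ v w → Wf v w) where

    -- The generated vertices form a convex set containing P. For distinct generated neighbours a, b
    -- of v, `Gen-turn` either generates v at once or generates both away from v, and then they join
    -- at v. Decidability turns this set into a `Subset`.
    hull⇒Gen : ∀ {P} → (∀ x → Dec (P x)) → ∀ {x} → InHull G P x → Gen P x x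
    hull⇒Gen {P} P? inHull = from (inHull U convex (λ y p → to (base p)))
      where
      gen? : ∀ y → Dec (Gen P y y)
      gen? y = Gen? P? (wf y y)
      U : Subset n
      U = Vec.tabulate (does ∘ gen?)
      to : ∀ {y} → Gen P y y → y ∈ˢ U
      to {y} g = lookup⇒[]= y U (trans (lookup∘tabulate (does ∘ gen?) y) (dec-true (gen? y) g))
      from : ∀ {y} → y ∈ˢ U → Gen P y y
      from {y} y∈U = does-true (gen? y) (trans (sym (lookup∘tabulate (does ∘ gen?) y)) ([]=⇒lookup y∈U))
      convex : IsConvex G U
      convex v v∉U a b a∈U b∈U v~a v~b = decidable-stable (a ≟ b) λ a≢b →
        absurd a≢b (Gen-turn (from a∈U) (~-sym v~a)) (Gen-turn (from b∈U) (~-sym v~b))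
        where
        absurd : a ≢ b → Gen P a v ⊎ Gen P v a → Gen P b v ⊎ Gen P v b → ⊥
        absurd a≢b (inj₂ g)  _         = v∉U (to (Gen-widen g))
        absurd a≢b (inj₁ _)  (inj₂ g)  = v∉U (to (Gen-widen g))
        absurd a≢b (inj₁ ga) (inj₁ gb) = v∉U (to
          (join a≢b (~-sym v~a) (~-sym v~b) (~⇒≢ (~-sym v~a)) (~⇒≢ (~-sym v~b)) ga gb))

  module _ (acyclic : Acyclic G) where

    NB⇒linked : ∀ {l} → NB l → Linked _~_ l
    NB⇒linked (edge x~y)     = x~y ∷ [-]
    NB⇒linked (cons x~y _ l) = x~y ∷ NB⇒linked l

    -- By induction the tail has no repetition; if the head recurred in it, the stretch up to that
    -- recurrence would close into a cycle.
    NB⇒unique : ∀ {l} → NB l → Unique l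
    NB⇒unique (edge x~y) = (~⇒≢ x~y ∷ []) ∷ [] ∷ []
    NB⇒unique {x ∷ y ∷ z ∷ l} nb@(cons x~y x≢z rest) = All.¬Any⇒All¬ _ fresh ∷ uniq
      where
      uniq : Unique (y ∷ z ∷ l)
      uniq = NB⇒unique rest
      fresh : x ∉ y ∷ z ∷ l
      fresh (here x≡y)         = ~⇒≢ x~y x≡y
      fresh (there (here x≡z)) = x≢z x≡z
      fresh (there (there x∈l)) with ∈-∃++ x∈l
      ... | ps , qs , refl = acyclic (x , y ∷ z ∷ ps , s≤s (s≤s z≤n) ,
              All.¬Any⇒All¬ _ x∉ ∷ unique-prefix (y ∷ z ∷ ps) uniq ,
              linked-prefix (x ∷ y ∷ z ∷ ps) (NB⇒linked nb))
        where
        x∉ : x ∉ y ∷ z ∷ ps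
        x∉ (here x≡y)          = ~⇒≢ x~y x≡y
        x∉ (there (here x≡z))  = x≢z x≡z
        x∉ (there (there x∈ps)) = disjoint ps x∈ps uniq′
          where
          uniq′ : Unique (ps ++ x ∷ qs)
          uniq′ with uniq
          ... | _ ∷ _ ∷ u = u
          disjoint : ∀ ps → x ∈ ps → Unique (ps ++ x ∷ qs) → ⊥
          disjoint (p ∷ ps) (here refl) (p∉ ∷ _) = All.lookup p∉ (∈-++⁺ʳ ps (here refl)) refl
          disjoint (p ∷ ps) (there x∈)  (_ ∷ u)  = disjoint ps x∈ u

    -- Following the branch from u to x prolongs the walk at its head without turning back, so x
    -- becomes the head of a walk without repetition.
    extend : ∀ {u v x l} → Br u v x → NB (u ∷ v ∷ l) → x ∉ v ∷ l
    extend here nb x∈ with NB⇒unique nb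
    ... | u∉ ∷ _ = All.lookup u∉ x∈ refl
    extend (step u′~u u′≢v br) nb x∈ = extend br (cons u′~u u′≢v nb) (there x∈)

    path : ∀ {u v x} → u ~ v → Br u v x → ∃ λ l → NB (v ∷ u ∷ l) × x ∈ u ∷ l
    path u~v here = [] , edge (~-sym u~v) , here refl
    path u~v (step u′~u u′≢v br) with path u′~u br
    ... | l , nb , x∈ = _ , cons (~-sym u~v) (u′≢v ∘ sym) nb , there x∈

    Br-root : ∀ {u v} → u ~ v → ¬ Br u v v
    Br-root u~v br = extend br (edge u~v) (here refl)

    -- A walk that reaches x through u′ could otherwise be continued through v and u down to x
    -- again.
    Br-disjoint : ∀ {u u′ v x} → u ~ v → u′ ~ v → Br u v x → Br u′ v x → u ≡ u′
    Br-disjoint {u} {u′} u~v u′~v br br′ with u ≟ u′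
    ... | yes u≡u′ = u≡u′
    ... | no u≢u′ with path u′~v br′
    ...   | l , nb , x∈ = ⊥-elim (extend br (cons u~v u≢u′ nb) (there x∈))

    -- Each descent lengthens a walk that never turns back, and such a walk has at most n vertices.
    wf-fuel : ∀ k {u v l} → NB (u ∷ v ∷ l) → n < k + length (u ∷ v ∷ l) → Wf u v
    wf-fuel zero    nb n< = contradiction (unique-length (NB⇒unique nb)) (<⇒≱ n<)
    wf-fuel (suc k) nb n< = node λ u′ u′~u u′≢v →
      wf-fuel k (cons u′~u u′≢v nb) (subst (n <_) (sym (+-suc k _)) n<)

    wf : ∀ v w → Wf v w
    wf v w = node λ u u~v _ → wf-fuel n (edge u~v) (m<m+n n (s≤s z≤n))

  Br? : ∀ {v w} → Wf v w → ∀ x → Dec (Br v w x)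
  Br? {v} {w} (node sub) x = map′ to from ((v ≟ x) ⊎-dec any? via?)
    where
    Via : Fin n → Set
    Via u = Σ (u ~ v) λ _ → Σ (u ≢ w) λ _ → Br u v x
    via? : ∀ u → Dec (Via u)
    via? u with u ~? v | u ≟ w
    ... | no ¬u~v | _        = no (¬u~v ∘ proj₁)
    ... | yes _   | yes u≡w  = no λ (_ , u≢w , _) → u≢w u≡w
    ... | yes u~v | no u≢w   = map′ (λ br → u~v , u≢w , br) (proj₂ ∘ proj₂) (Br? (sub u u~v u≢w) x)
    to : v ≡ x ⊎ ∃ Via → Br v w x
    to (inj₁ refl)                   = here
    to (inj₂ (u , u~v , u≢w , br)) = step u~v u≢w br
    from : Br v w x → v ≡ x ⊎ ∃ Via
    from here                = inj₁ refl
    from (step u~v u≢w br) = inj₂ (_ , u~v , u≢w , br)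

-- Gluing selections in the branches below a vertex into a 2-anti-Radon selection.

bit : Bool → ℕ
bit false = 0
bit true  = 1

module Selection {n} (G : Graph n) (acyclic : Acyclic G) where
  open Tree G
  open DecMembership (_≟_ {n}) using (_∈?_)

  Child : Fin n → Fin n → Fin n → Set
  Child v w u = u ~ v × u ≢ w

  child? : ∀ v w u → Dec (Child v w u)
  child? v w u = (u ~? v) ×-dec ¬? (u ≟ w)

  -- Limits on what v may send towards w when the selected vertices are split
  -- into the two parts P false and P true.
  Lim : (Bool → Fin n → Set) → Bool → Fin n → Fin n → Set
  Lim P false v w = ∀ s → ¬ Gen (P s) v w
  Lim P true  v w = ¬ (Gen (P false) v w × Gen (P true) v w)

  -- The selection S sends at most o from v to w, and tolerates i from w to v.
  Valid : Fin n → Fin n → List (Fin n) → Bool → Bool → Set₁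
  Valid v w S o i = (P : Bool → Fin n → Set) →
    (∀ s {x} → Br v w x → P s x → x ∈ S) → (∀ {x} → Br v w x → P false x → ¬ P true x) →
    Lim P o v w × ((w ~ v → Lim P i w v) → ∀ {x} → Br v w x → ¬ (Gen (P false) x x × Gen (P true) x x))

  record Sel (v w : Fin n) (ℓ : ℕ) (o i : Bool) : Set₁ where
    field
      S      : List (Fin n)
      inside : ∀ {x} → x ∈ S → Br v w x
      unique : Unique S
      size   : ℓ ≤ length S
      valid  : Valid v w S o i

  Lim⇒≤1 : ∀ {P} o {v w} → Lim P o v w → Lim P true v w
  Lim⇒≤1 false lim (g , _) = lim false g
  Lim⇒≤1 true  lim = lim

  Sel-smaller : ∀ {v w ℓ ℓ′ o i} → ℓ′ ≤ ℓ → Sel v w ℓ o i → Sel v w ℓ′ o i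
  Sel-smaller ℓ′≤ℓ sel = record
    { S = S ; inside = inside ; unique = unique ; size = ≤-trans ℓ′≤ℓ size ; valid = valid }
    where open Sel sel

  Sel-relax : ∀ {v w ℓ} i → Sel v w ℓ false true → Sel v w ℓ true i
  Sel-relax i sel = record
    { S = S ; inside = inside ; unique = unique ; size = size
    ; valid = λ P P⊆S P-disjoint → let (out , inner) = valid P P⊆S P-disjoint in
        Lim⇒≤1 {P} false out , λ lim → inner (Lim⇒≤1 {P} i ∘ lim) }
    where open Sel sel

  -- N lists the children allowed to send, `vin` says whether v is selected, and `bit i` counts the
  -- parent as a sender. Two parts generating v from outside take four senders (`few`); if v is
  -- selected, two are already too many (`few-v`). A child that tolerates nothing must be a sender
  -- with at most one other beside it (`few-ι`), and v stays silent when unselected with at most one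
  -- sending child (`few-o`).
  module Glue (v w : Fin n) (vin : Bool) (σ ι : Fin n → Bool) (ℓ : Fin n → ℕ) (N : List (Fin n)) (o i : Bool)
    (σ⊆N : ∀ u → σ u ≡ true → u ∈ N)
    (no-child : ∀ u → ¬ Child v w u → ℓ u ≡ 0)
    (sel : ∀ u → Child v w u → Sel u v (ℓ u) (σ u) (ι u))
    (few : length N + bit i ≤ 3)
    (few-v : vin ≡ true → length N + bit i ≤ 1)
    (few-ι : ∀ u → ι u ≡ false → vin ≡ false × u ∈ N × length N + bit i ≤ 2)
    (few-o : o ≡ false → vin ≡ false × length N ≤ 1)
    where

    root : Bool → List (Fin n)
    root true  = [ v ]
    root false = []

    part : ∀ u → Dec (Child v w u) → List (Fin n)
    part u (yes c) = Sel.S (sel u c)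
    part u (no _)  = []

    parts : Fin n → List (Fin n)
    parts u = part u (child? v w u)

    S : List (Fin n)
    S = root vin ++ concat (tabulate parts)

    root-size : ∀ b → length (root b) ≡ bit b
    root-size true  = refl
    root-size false = refl

    ∈root : ∀ b {x} → x ∈ root b → x ≡ v × b ≡ true
    ∈root true (here x≡v) = x≡v , refl

    root-unique : ∀ b → Unique (root b)
    root-unique true  = [] ∷ []
    root-unique false = []

    part-inside : ∀ u d {x} → x ∈ part u d → Child v w u × Br u v x
    part-inside u (yes c) x∈ = c , Sel.inside (sel u c) x∈

    part-unique : ∀ u d → Unique (part u d)
    part-unique u (yes c) = Sel.unique (sel u c)
    part-unique u (no _)  = []

    part-size : ∀ u d → ℓ u ≤ length (part u d)
    part-size u (yes c) = Sel.size (sel u c)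
    part-size u (no ¬c) = ≤-reflexive (no-child u ¬c)

    part-valid : ∀ u d → Child v w u → Valid u v (part u d) (σ u) (ι u)
    part-valid u (yes c) _ = Sel.valid (sel u c)
    part-valid u (no ¬c) c = contradiction c ¬c

    ∈parts : ∀ {x} → x ∈ concat (tabulate parts) → ∃ λ u → x ∈ parts u
    ∈parts x∈ with ∈-concat⁻′ (tabulate parts) x∈
    ... | xs , x∈xs , xs∈ with ∈-tabulate⁻ xs∈
    ...   | u , refl = u , x∈xs

    ∈S : ∀ {x} → x ∈ S → (x ≡ v × vin ≡ true) ⊎ ∃ λ u → Child v w u × Br u v x × x ∈ parts u
    ∈S x∈ with ∈-++⁻ (root vin) x∈
    ... | inj₁ x∈root = inj₁ (∈root vin x∈root)
    ... | inj₂ x∈rest with ∈parts x∈rest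
    ...   | u , x∈u with part-inside u (child? v w u) x∈u
    ...     | c , br = inj₂ (u , c , br , x∈u)

    inside : ∀ {x} → x ∈ S → Br v w x
    inside x∈ with ∈S x∈
    ... | inj₁ (refl , _) = here
    ... | inj₂ (u , (u~v , u≢w) , br , _) = step u~v u≢w br

    unique : Unique S
    unique = ++⁺ (root-unique vin)
      (concat⁺ (All.tabulate⁺ λ u → part-unique u (child? v w u)) (AllPairs.tabulate⁺ disjoint))
      λ (x∈root , x∈rest) → clash (proj₁ (∈root vin x∈root)) (∈parts x∈rest)
      where
      disjoint : ∀ {u u′} → u ≢ u′ → ∀ {x} → ¬ (x ∈ parts u × x ∈ parts u′)
      disjoint {u} {u′} u≢u′ (x∈u , x∈u′)
        with part-inside u (child? v w u) x∈u | part-inside u′ (child? v w u′) x∈u′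
      ... | (u~v , _) , br | (u′~v , _) , br′ = u≢u′ (Br-disjoint acyclic u~v u′~v br br′)
      clash : ∀ {x} → x ≡ v → ¬ ∃ λ u → x ∈ parts u
      clash refl (u , x∈u) with part-inside u (child? v w u) x∈u
      ... | (u~v , _) , br = Br-root acyclic u~v br

    size : bit vin + sum ℓ ≤ length S
    size = begin
      bit vin + sum ℓ                             ≤⟨ +-mono-≤ (≤-reflexive (sym (root-size vin))) (sum-mono λ u → part-size u (child? v w u)) ⟩
      length (root vin) + sum (length ∘ parts)    ≡⟨ cong (length (root vin) +_) (sym (length-concat-tabulate parts)) ⟩
      length (root vin) + length (concat (tabulate parts)) ≡⟨ sym (length-++ (root vin)) ⟩
      length S                                    ∎
      where open ≤-Reasoning

    module _ (P : Bool → Fin n → Set) (P⊆S : ∀ s {x} → Br v w x → P s x → x ∈ S)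
      (P-disjoint : ∀ {x} → Br v w x → P false x → ¬ P true x) where

      P⊆part : ∀ {u} → Child v w u → ∀ s {x} → Br u v x → P s x → x ∈ parts u
      P⊆part {u} (u~v , u≢w) s {x} br p with ∈S (P⊆S s (step u~v u≢w br) p)
      ... | inj₁ (refl , _) = contradiction br (Br-root acyclic u~v)
      ... | inj₂ (u′ , (u′~v , _) , br′ , x∈) =
        subst (λ y → x ∈ parts y) (Br-disjoint acyclic u′~v u~v br′ br) x∈

      child-valid : ∀ {u} → Child v w u → Lim P (σ u) u v ×
        ((v ~ u → Lim P (ι u) v u) → ∀ {x} → Br u v x → ¬ (Gen (P false) x x × Gen (P true) x x))
      child-valid {u} c@(u~v , u≢w) = part-valid u (child? v w u) c P (P⊆part c)
        (P-disjoint ∘ step u~v u≢w)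

      P⇒vin : ∀ s → P s v → vin ≡ true
      P⇒vin s p with ∈S (P⊆S s here p)
      ... | inj₁ (_ , eq) = eq
      ... | inj₂ (u , (u~v , _) , br , _) = contradiction br (Br-root acyclic u~v)

      child-sends : ∀ {u} s → Child v w u → Gen (P s) u v → u ∈ N
      child-sends {u} s c g with σ u in eq | proj₁ (child-valid c)
      ... | true  | _   = σ⊆N u eq
      ... | false | lim = contradiction g (lim s)

      child-once : ∀ {u} → Child v w u → ¬ (Gen (P false) u v × Gen (P true) u v)
      child-once {u} c = Lim⇒≤1 {P} (σ u) (proj₁ (child-valid c))

      -- Applied with z = w for the message to the parent, and with z = v for generation of v from
      -- all sides.
      module Incoming (L : List (Fin n)) (z : Fin n)
        (sends : ∀ {u} s → Child v z u → Gen (P s) u v → u ∈ L)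
        (once : ∀ {u} → Child v z u → ¬ (Gen (P false) u v × Gen (P true) u v))
        where

        two : ∀ s → Gen (P s) v z → P s v ⊎ 2 ≤ length L
        two s (base p) = inj₁ p
        two s (join x≢y x~v y~v x≢z y≢z gx gy) = inj₂ (unique-⊆-length ((x≢y ∷ []) ∷ [] ∷ []) λ
          { (here refl) → sends s (x~v , x≢z) gx ; (there (here refl)) → sends s (y~v , y≢z) gy })

        -- Either v lies in one part and the other needs two senders, or each part needs two; the
        -- four are distinct because no neighbour sends both parts.
        clash : length L ≤ 3 → (vin ≡ true → length L ≤ 1) → ¬ (Gen (P false) v z × Gen (P true) v z)
        clash ≤3 ≤1 (base p , base p′) = P-disjoint here p p′
        clash ≤3 ≤1 (base p , g) with two true g
        ... | inj₁ p′ = P-disjoint here p p′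
        ... | inj₂ 2≤ = contradiction (≤-trans 2≤ (≤1 (P⇒vin false p))) λ { (s≤s ()) }
        clash ≤3 ≤1 (g , base p) with two false g
        ... | inj₁ p′ = P-disjoint here p′ p
        ... | inj₂ 2≤ = contradiction (≤-trans 2≤ (≤1 (P⇒vin true p))) λ { (s≤s ()) }
        clash ≤3 ≤1 (join {a} {b} a≢b a~v b~v a≢z b≢z ga gb , join {c} {d} c≢d c~v d~v c≢z d≢z gc gd) =
          contradiction (≤-trans four ≤3) λ { (s≤s (s≤s (s≤s ()))) }
          where
          apart : ∀ {x y} → Child v z x → Gen (P false) x v → Gen (P true) y v → x ≢ y
          apart c g g′ refl = once c (g , g′)
          A = a~v , a≢z
          B = b~v , b≢z
          four : 4 ≤ length L
          four = unique-⊆-length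
            ((a≢b ∷ apart A ga gc ∷ apart A ga gd ∷ []) ∷ (apart B gb gc ∷ apart B gb gd ∷ []) ∷ (c≢d ∷ []) ∷ [] ∷ [])
            λ { (here refl) → sends false A ga
              ; (there (here refl)) → sends false B gb
              ; (there (there (here refl))) → sends true (c~v , c≢z) gc
              ; (there (there (there (here refl)))) → sends true (d~v , d≢z) gd }

      out-at : ∀ b → o ≡ b → Lim P b v w
      out-at true _ = clash (≤-trans (m≤m+n _ (bit i)) few) (λ h → ≤-trans (m≤m+n _ (bit i)) (few-v h))
        where open Incoming N w child-sends child-once
      out-at false eq s g = no-send (two s g)
        where
        open Incoming N w child-sends child-once
        no-send : ¬ (P s v ⊎ 2 ≤ length N)
        no-send (inj₁ p) = contradiction (trans (sym (proj₁ (few-o eq))) (P⇒vin s p)) λ ()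
        no-send (inj₂ 2≤) = contradiction (≤-trans 2≤ (proj₂ (few-o eq))) λ { (s≤s ()) }

      module _ (in-lim : w ~ v → Lim P i w v) where

        senders : Bool → List (Fin n)
        senders false = N
        senders true  = w ∷ N

        senders-size : ∀ b → length (senders b) ≡ length N + bit b
        senders-size false = sym (+-identityʳ _)
        senders-size true  = +-comm 1 (length N)

        N⊆senders : ∀ b {u} → u ∈ N → u ∈ senders b
        N⊆senders false u∈ = u∈
        N⊆senders true  u∈ = there u∈

        sends : ∀ {u} s → u ~ v → Gen (P s) u v → u ∈ senders i
        sends {u} s u~v g with u ≟ w
        ... | no u≢w = N⊆senders i (child-sends s (u~v , u≢w) g)
        ... | yes refl = outer-sends i (in-lim u~v)
          where
          outer-sends : ∀ b → Lim P b w v → w ∈ senders b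
          outer-sends true  _   = here refl
          outer-sends false lim = contradiction g (lim s)

        once : ∀ {u} → u ~ v → ¬ (Gen (P false) u v × Gen (P true) u v)
        once {u} u~v with u ≟ w
        ... | no u≢w   = child-once (u~v , u≢w)
        ... | yes refl = Lim⇒≤1 {P} i (in-lim u~v)

        at-v : ¬ (Gen (P false) v v × Gen (P true) v v)
        at-v = clash (subst (_≤ 3) (sym (senders-size i)) few)
                     (λ h → subst (_≤ 1) (sym (senders-size i)) (few-v h))
          where open Incoming (senders i) v (λ s c → sends s (proj₁ c)) (once ∘ proj₁)

        -- A tolerant child is covered by `at-v`. For any other child u, a message from v would need
        -- two senders besides u, and u itself would make three.
        into-child : ∀ {u} → Child v w u → v ~ u → Lim P (ι u) v u
        into-child {u} c _ with ι u in eq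
        ... | true  = λ (g , g′) → at-v (Gen-widen g , Gen-widen g′)
        ... | false = silent
          where
          ¬vin : vin ≢ true
          ¬vin vin≡ = contradiction (trans (sym (proj₁ (few-ι u eq))) vin≡) λ ()
          silent : ∀ s → ¬ Gen (P s) v u
          silent s (base p) = ¬vin (P⇒vin s p)
          silent s (join x≢y x~v y~v x≢u y≢u gx gy) =
            contradiction (≤-trans three (subst (_≤ 2) (sym (senders-size i)) (proj₂ (proj₂ (few-ι u eq)))))
              λ { (s≤s (s≤s ())) }
            where
            three : 3 ≤ length (senders i)
            three = unique-⊆-length ((x≢y ∷ x≢u ∷ []) ∷ (y≢u ∷ []) ∷ [] ∷ [])
              λ { (here refl) → sends s x~v gx
                ; (there (here refl)) → sends s y~v gy
                ; (there (there (here refl))) → N⊆senders i (proj₁ (proj₂ (few-ι u eq))) }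

        inner : ∀ {x} → Br v w x → ¬ (Gen (P false) x x × Gen (P true) x x)
        inner here = at-v
        inner (step u~v u≢w br) = proj₂ (child-valid (u~v , u≢w)) (into-child (u~v , u≢w)) br

    glued : Sel v w (bit vin + sum ℓ) o i
    glued = record { S = S ; inside = inside ; unique = unique ; size = size
                   ; valid = λ P P⊆S P-disjoint → out-at P P⊆S P-disjoint o refl , inner P P⊆S P-disjoint }

-- Sums over chosen children, and the combinations of kinds below a vertex.

sum-map-concat : ∀ {A : Set} {n} (f : A → ℕ) (g : Fin n → List A) →
  sumˡ (map f (concat (tabulate g))) ≡ sum (λ u → sumˡ (map f (g u)))
sum-map-concat {n = zero}  f g = refl
sum-map-concat {n = suc n} f g = begin
  sumˡ (map f (g zero ++ rest))                           ≡⟨ cong sumˡ (map-++ f (g zero) rest) ⟩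
  sumˡ (map f (g zero) ++ map f rest)                     ≡⟨ sum-++ (map f (g zero)) (map f rest) ⟩
  sumˡ (map f (g zero)) + sumˡ (map f rest)     ≡⟨ cong (sumˡ (map f (g zero)) +_) (sum-map-concat f (g ∘ suc)) ⟩
  sum (λ u → sumˡ (map f (g u)))                          ∎
  where
  open ≡-Reasoning
  rest = concat (tabulate (g ∘ suc))

module _ {n : ℕ} where
  open DecMembership (_≟_ {n}) using (_∈?_)

  picked : List (Fin n) → (Fin n → ℕ) → Fin n → ℕ
  picked N g u = if does (u ∈? N) then g u else 0

  sum-picked : ∀ {N} g → Unique N → sum (picked N g) ≡ sumˡ (map g N)
  sum-picked {[]}    g _ = sum-zero {f = picked [] g} λ _ → refl
  sum-picked {i ∷ N} g (i∉ ∷ N!) = begin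
    sum (picked (i ∷ N) g)                          ≡⟨ sum-cong-≗ peel ⟩
    sum (λ u → single i (g i) u + picked N g u)     ≡⟨ ∑-distrib-+ (single i (g i)) (picked N g) ⟩
    sum (single i (g i)) + sum (picked N g)         ≡⟨ cong₂ _+_ (sum-single i (g i)) (sum-picked g N!) ⟩
    g i + sumˡ (map g N)                  ∎
    where
    open ≡-Reasoning
    peel : ∀ u → picked (i ∷ N) g u ≡ single i (g i) u + picked N g u
    peel u with u ≟ i
    ... | yes refl rewrite dec-false (i ∈? N) (λ i∈N → All.lookup i∉ i∈N refl) | single-at i (g i) = sym (+-identityʳ (g i))
    ... | no u≢i rewrite update-off (const 0) i (g i) u≢i with does (u ∈? N)
    ...   | true  = refl
    ...   | false = refl

gain : Kind → ℕ
gain null   = 0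
gain loose  = 1
gain tight  = 1
gain double = 2

tolerant : Kind → Bool
tolerant loose = true
tolerant _     = false

-- Each constructor names the children that decide the kind of v and carries the absence facts
-- required by the matching bound of `Budget`.
data Pattern {n} (κ : Fin n → Kind) : Set where
  doubles     : ∀ i j → i ≢ j → κ i ≡ double → κ j ≡ double → Pattern κ
  double-plus : ∀ i j → i ≢ j → κ i ≡ double → (∀ u → u ≢ i → κ u ≢ double) → κ j ≢ null → Pattern κ
  lone-double : ∀ i → κ i ≡ double → (∀ u → u ≢ i → κ u ≡ null) → Pattern κ
  loose-3     : ∀ i j k → i ≢ j → i ≢ k → j ≢ k → (∀ u → κ u ≢ double) →
                κ i ≡ loose → κ j ≡ loose → κ k ≡ loose → Pattern κ
  loose-2     : ∀ i j → i ≢ j → (∀ u → κ u ≢ double) → κ i ≡ loose → κ j ≡ loose →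
                (∀ u → u ≢ i → u ≢ j → κ u ≢ loose) → Pattern κ
  loose-1     : ∀ i → (∀ u → κ u ≢ double) → κ i ≡ loose → (∀ u → u ≢ i → κ u ≢ loose) → Pattern κ
  tights      : ∀ i j → i ≢ j → (∀ u → κ u ≢ double) → (∀ u → κ u ≢ loose) →
                κ i ≡ tight → κ j ≡ tight → Pattern κ
  lone-tight  : ∀ i → κ i ≡ tight → (∀ u → u ≢ i → κ u ≡ null) → Pattern κ
  nulls       : (∀ u → κ u ≡ null) → Pattern κ

kind-null : ∀ k → k ≢ double → k ≢ loose → k ≢ tight → k ≡ null
kind-null null   _ _ _ = refl
kind-null loose  _ h _ = contradiction refl h
kind-null tight  _ _ h = contradiction refl h
kind-null double h _ _ = contradiction refl h

classify : ∀ {n} (κ : Fin n → Kind) → Pattern κ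
classify κ with any? (λ i → κ i ≟ᵏ double)
... | yes (i , di) = with-double (any? λ j → ¬? (i ≟ j) ×-dec (κ j ≟ᵏ double)) (any? λ j → ¬? (i ≟ j) ×-dec ¬? (κ j ≟ᵏ null))
  where
  with-double : Dec (∃ λ j → i ≢ j × κ j ≡ double) → Dec (∃ λ j → i ≢ j × κ j ≢ null) → Pattern κ
  with-double (yes (j , i≢j , dj)) _ = doubles i j i≢j di dj
  with-double (no none) (yes (j , i≢j , nj)) = double-plus i j i≢j di (λ u u≢i du → none (u , u≢i ∘ sym , du)) nj
  with-double (no _) (no none) = lone-double i di λ u u≢i →
    decidable-stable (κ u ≟ᵏ null) λ nu → none (u , u≢i ∘ sym , nu)
... | no ¬double with any? (λ i → κ i ≟ᵏ loose)
...   | yes (i , li) = with-loose (any? λ j → ¬? (i ≟ j) ×-dec (κ j ≟ᵏ loose))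
  where
  with-loose : Dec (∃ λ j → i ≢ j × κ j ≡ loose) → Pattern κ
  with-loose (no none) = loose-1 i (λ u du → ¬double (u , du)) li λ u u≢i lu → none (u , u≢i ∘ sym , lu)
  with-loose (yes (j , i≢j , lj)) with any? (λ k → ¬? (i ≟ k) ×-dec ¬? (j ≟ k) ×-dec (κ k ≟ᵏ loose))
  ... | yes (k , i≢k , j≢k , lk) = loose-3 i j k i≢j i≢k j≢k (λ u du → ¬double (u , du)) li lj lk
  ... | no none = loose-2 i j i≢j (λ u du → ¬double (u , du)) li lj
        λ u u≢i u≢j lu → none (u , u≢i ∘ sym , u≢j ∘ sym , lu)
...   | no ¬loose with any? (λ i → κ i ≟ᵏ tight)
...     | no ¬tight = nulls λ u → kind-null (κ u) (λ d → ¬double (u , d)) (λ l → ¬loose (u , l)) (λ h → ¬tight (u , h))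
...     | yes (i , ti) with any? (λ j → ¬? (i ≟ j) ×-dec (κ j ≟ᵏ tight))
...       | yes (j , i≢j , tj) = tights i j i≢j (λ u d → ¬double (u , d)) (λ u l → ¬loose (u , l)) ti tj
...       | no none = lone-tight i ti λ u u≢i → kind-null (κ u) (λ d → ¬double (u , d)) (λ l → ¬loose (u , l))
                        λ h → none (u , u≢i ∘ sym , h)

-- Multiplicities in a multi-set.

mult : ∀ {n} → List (Fin n) → Fin n → ℕ
mult []      v = 0
mult (x ∷ R) v = (if does (x ≟ v) then 1 else 0) + mult R v

-- Numbers the copies of v, so that each copy can be put into a part of its own.
rank : ∀ {n} (R : List (Fin n)) v → ∃ λ (g : Fin (length R) → ℕ) →
  ∀ i → i < mult R v → ∃ λ j → lookup R j ≡ v × g j ≡ i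
rank []      v = (λ ()) , λ _ ()
rank (x ∷ R) v with rank R v
... | g , hits = g′ , hits′
  where
  g′ : Fin (suc (length R)) → ℕ
  g′ zero    = mult R v
  g′ (suc j) = g j
  later : ∀ i → i < mult R v → ∃ λ j → lookup (x ∷ R) j ≡ v × g′ j ≡ i
  later i i< with hits i i<
  ... | j , Rj≡v , gj≡i = suc j , Rj≡v , gj≡i
  hits′ : ∀ i → i < mult (x ∷ R) v → ∃ λ j → lookup (x ∷ R) j ≡ v × g′ j ≡ i
  hits′ i i< with x ≟ v
  ... | no _ = later i i<
  ... | yes x≡v with m<1+n⇒m<n∨m≡n i<
  ...   | inj₁ i<m = later i i<m
  ...   | inj₂ refl = zero , x≡v , refl

weight : ∀ {n} → List (Fin n) → List (Fin n) → ℕ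
weight R Vs = sumˡ (map (mult R) Vs)

-- Every entry of R is counted where its vertex occurs in `Vs`; repetitions in `Vs` only enlarge the
-- weight.
length≤weight : ∀ {n} (R Vs : List (Fin n)) → (∀ x → x ∈ Vs) → length R ≤ weight R Vs
length≤weight []      Vs all = z≤n
length≤weight (x ∷ R) Vs all = ≤-trans (s≤s (length≤weight R Vs all)) (grow (all x))
  where
  keep : ∀ Vs → weight R Vs ≤ weight (x ∷ R) Vs
  keep []       = z≤n
  keep (y ∷ Vs) = +-mono-≤ (m≤n+m (mult R y) _) (keep Vs)
  grow : ∀ {Vs} → x ∈ Vs → suc (weight R Vs) ≤ weight (x ∷ R) Vs
  grow {y ∷ Vs} (here refl) with x ≟ x
  ... | yes _  = s≤s (+-monoʳ-≤ (mult R x) (keep Vs))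
  ... | no x≢x = contradiction refl x≢x
  grow {y ∷ Vs} (there x∈) = ≤-trans (≤-reflexive (sym (+-suc (mult R y) _))) (+-mono-≤ (m≤n+m (mult R y) _) (grow x∈))

-- Messages inside a k-anti-Radon multi-set, with t = k - 1.

module Radon {n} (G : Graph n) (acyclic : Acyclic G) (R : List (Fin n)) (t : ℕ) (1≤t : 1 ≤ t)
  (anti : AntiRadon G (suc t) R) where
  open Tree G
  open Selection G acyclic
  open DecMembership (_≟_ {n}) using (_∈?_)

  Position : Set
  Position = Fin (length R)

  Colour : (Position → ℕ) → ℕ → Fin n → Set
  Colour f i y = ∃ λ j → lookup R j ≡ y × f j ≡ i

  -- q disjoint parts of R, each of which generates v within Br v w.
  Coloured : Fin n → Fin n → ℕ → Set
  Coloured v w q = Σ (Position → ℕ) λ f → ∀ i → i < q → Gen (Colour f i) v w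

  -- With t + 1 colours generating v, the vertex v would be common to t + 1 hulls. Entries with a
  -- colour above t go to part zero, which can only enlarge its hull.
  Coloured⇒≤ : ∀ {v w q} → Coloured v w q → q ≤ t
  Coloured⇒≤ {v} {w} {q} (f , gen) = ≮⇒≥ λ t<q → anti (f′ , v , λ i →
    Gen⇒hull (Gen-mono (λ _ (j , Rj≡ , fj≡) → j , Rj≡ , same j i fj≡) (gen (toℕ i) (≤-trans (toℕ<n i) t<q))))
    where
    clip : ℕ → Fin (suc t)
    clip c with c <? suc t
    ... | yes c< = fromℕ< c<
    ... | no _   = zero
    f′ : Position → Fin (suc t)
    f′ j = clip (f j)
    same : ∀ j i → f j ≡ toℕ i → f′ j ≡ i
    same j i fj≡ = trans (cong clip fj≡) clip-toℕ
      where
      clip-toℕ : clip (toℕ i) ≡ i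
      clip-toℕ with toℕ i <? suc t
      ... | yes i< = fromℕ<-toℕ i i<
      ... | no i≮  = contradiction (toℕ<n i) i≮

  -- The zero alternative makes messages total functions on `Fin n`, with value zero at vertices
  -- that send nothing.
  Incoming : Fin n → Fin n → ℕ → Set
  Incoming u v q = q ≡ 0 ⊎ u ~ v × Coloured u v q

  Incoming⇒≤ : ∀ {u v q} → Incoming u v q → q ≤ t
  Incoming⇒≤ (inj₁ refl)   = z≤n
  Incoming⇒≤ (inj₂ (_ , c)) = Coloured⇒≤ c

  -- McNaughton's wrap-around rule: laid out consecutively modulo q, the capped
  -- families meet every residue twice and no family meets a residue twice.
  combine : ∀ v (α : Fin n → ℕ) → (∀ u → Incoming u v (α u)) → ∀ z → α z ≡ 0 → ∀ q →
    q + q ≤ sum (cap q α) → Coloured v z (mult R v + q)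
  combine v α inc z αz≡0 q 2q≤ = f , generated
    where
    m = mult R v
    y = cap q α

    shade : ∀ u → Incoming u v (α u) → Position → ℕ
    shade u (inj₁ _)           = const 0
    shade u (inj₂ (_ , g , _)) = g

    -- Subtracting q once is enough, as only the first 2q positions are read. Shades beyond the cap
    -- also receive colours, which merely adds entries to parts.
    slot : Fin n → ℕ → ℕ
    slot u l with prefix y u + l <? q
    ... | yes _ = prefix y u + l
    ... | no _  = prefix y u + l ∸ q

    Via : Fin n → Fin n → Set
    Via x u = u ~ v × Br u v x

    via? : ∀ x → Dec (∃ (Via x))
    via? x = any? λ u → (u ~? v) ×-dec Br? (wf acyclic u v) x

    -- The copies of v take the first m colours; entries in the branches take colours from m on, so
    -- colour m + s is generated by a pair of neighbours.
    paint′ : ∀ {x} → Dec (v ≡ x) → Dec (∃ (Via x)) → Position → ℕ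
    paint′ (yes _) _             j = proj₁ (rank R v) j
    paint′ (no _)  (yes (u , _)) j = m + slot u (shade u (inc u) j)
    paint′ (no _)  (no _)        j = 0

    paint : Fin n → Position → ℕ
    paint x = paint′ (v ≟ x) (via? x)

    f : Position → ℕ
    f j = paint (lookup R j) j

    paint-root : ∀ {x} d d′ → v ≡ x → ∀ j → paint′ {x} d d′ j ≡ proj₁ (rank R v) j
    paint-root (yes _)  _ _   j = refl
    paint-root (no v≢x) _ v≡x j = contradiction v≡x v≢x

    paint-branch : ∀ {x u} d d′ → u ~ v → Br u v x → ∀ j → paint′ {x} d d′ j ≡ m + slot u (shade u (inc u) j)
    paint-branch (yes refl) _ u~v br j = contradiction br (Br-root acyclic u~v)
    paint-branch (no _) (yes (u′ , u′~v , br′)) u~v br j with Br-disjoint acyclic u′~v u~v br′ br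
    ... | refl = refl
    paint-branch (no _) (no none) u~v br j = contradiction (_ , u~v , br) none

    slot-low : ∀ {u l s} → s < q → prefix y u + l ≡ s → slot u l ≡ s
    slot-low {u} {l} s<q refl with prefix y u + l <? q
    ... | yes _ = refl
    ... | no ≮q = contradiction s<q ≮q

    slot-high : ∀ {u l s} → prefix y u + l ≡ q + s → slot u l ≡ s
    slot-high {u} {l} {s} eq with prefix y u + l <? q
    ... | yes <q = contradiction (subst (_< q) eq <q) (m+n≮m q s)
    ... | no _   = trans (cong (_∸ q) eq) (m+n∸m≡n q s)

    contribution : ∀ {u l s} → l < y u → slot u l ≡ s →
      u ≢ z × u ~ v × Gen (Colour f (m + s)) u v
    contribution {u} {l} {s} l<y slot≡ = u≢z , proj₁ source , Gen-mono recolour (proj₂ source)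
      where
      l<α : l < α u
      l<α = ≤-trans l<y (m⊓n≤m (α u) q)
      u≢z : u ≢ z
      u≢z refl = contradiction (subst (l <_) αz≡0 l<α) λ ()
      at : (d : Incoming u v (α u)) → u ~ v × Gen (Colour (shade u d) l) u v
      at (inj₁ α≡0)            = contradiction (subst (l <_) α≡0 l<α) λ ()
      at (inj₂ (u~v , g , gen)) = u~v , gen l l<α
      source : u ~ v × Gen (Colour (shade u (inc u)) l) u v
      source = at (inc u)
      recolour : ∀ {x} → Br u v x → Colour (shade u (inc u)) l x → Colour f (m + s) x
      recolour br (j , refl , shade≡) = j , refl ,
        trans (paint-branch (v ≟ lookup R j) (via? (lookup R j)) (proj₁ source) br j)
              (cong (m +_) (trans (cong (slot u) shade≡) slot≡))

    twice : ∀ s → s < q → Gen (Colour f (m + s)) v z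
    twice s s<q
      with locate y s (≤-trans s<q (≤-trans (m≤m+n q q) 2q≤)) | locate y (q + s) (≤-trans (+-monoʳ-< q s<q) 2q≤)
    ... | u₁ , l₁ , l₁< , eq₁ | u₂ , l₂ , l₂< , eq₂
      with contribution l₁< (slot-low s<q eq₁) | contribution l₂< (slot-high eq₂)
    ...   | u₁≢z , u₁~v , g₁ | u₂≢z , u₂~v , g₂ = join distinct u₁~v u₂~v u₁≢z u₂≢z g₁ g₂
      where
      distinct : u₁ ≢ u₂
      -- Positions s and q + s differ by q, so within one block the second offset would be at least
      -- q, while blocks are capped at length q.
      distinct refl = contradiction (≤-trans l₂< (m⊓n≤n (α u₁) q)) (≤⇒≯ q≤l₂)
        where
        q≤l₂ : q ≤ l₂
        q≤l₂ = subst (q ≤_) (+-cancelˡ-≡ (prefix y u₁) _ _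
          (sym (trans eq₂ (trans (cong (q +_) (sym eq₁)) (swap q (prefix y u₁) l₁))))) (m≤m+n q l₁)
          where
          swap : ∀ q p l → q + (p + l) ≡ p + (q + l)
          swap = solve-∀

    generated : ∀ i → i < m + q → Gen (Colour f i) v z
    generated i i< with i <? m
    ... | yes i<m with proj₂ (rank R v) i i<m
    ...   | j , refl , rank≡ = base (j , refl , trans (paint-root (v ≟ v) (via? v) refl j) rank≡)
    generated i i< | no i≮m = subst (λ c → Gen (Colour f c) v z) (m+[n∸m]≡n (≮⇒≥ i≮m))
      (twice (i ∸ m) (+-cancelˡ-< m _ _ (subst (_< m + q) (sym (m+[n∸m]≡n (≮⇒≥ i≮m))) i<)))

  -- Induction over branches: summaries and the kind of a vertex.

  record Summary : Set where
    field
      F    : ℕ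
      kind : Kind
      a W  : ℕ

  -- The field `bound` ranges over all messages b because the actual b depends on the tree outside
  -- the branch.
  record Correct (v w : Fin n) (s : Summary) : Set₁ where
    open Summary s
    field
      coloured : Coloured v w a
      cover    : ∃ λ Vs → (∀ {x} → Br v w x → x ∈ Vs) × weight R Vs ≤ W
      sel₀     : Sel v w F false true
      sel₁     : Sel v w (F + gain kind) true (tolerant kind)
      bound    : ∀ b → Incoming w v b → W ≤ t * F + surplus kind a (a ⊓ (t ∸ b))

  module Step (v w : Fin n) (IH : ∀ u → Child v w u → Σ Summary (Correct u v)) where

    m : ℕ
    m = mult R v

    -- The zero summary at all other vertices lets sums over `Fin n` stand for sums over children.
    summary : ∀ u → Dec (Child v w u) → Summary
    summary u (yes c) = proj₁ (IH u c)
    summary u (no _)  = record { F = 0 ; kind = null ; a = 0 ; W = 0 }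

    correct′ : ∀ u d → Child v w u → Correct u v (summary u d)
    correct′ u (yes c) _ = proj₂ (IH u c)
    correct′ u (no ¬c) c = contradiction c ¬c

    trivial′ : ∀ u d → ¬ Child v w u → summary u d ≡ record { F = 0 ; kind = null ; a = 0 ; W = 0 }
    trivial′ u (yes c) ¬c = contradiction c ¬c
    trivial′ u (no _)  _  = refl

    D : Fin n → Summary
    D u = summary u (child? v w u)

    correct : ∀ u → Child v w u → Correct u v (D u)
    correct u = correct′ u (child? v w u)

    trivial : ∀ u → ¬ Child v w u → D u ≡ record { F = 0 ; kind = null ; a = 0 ; W = 0 }
    trivial u = trivial′ u (child? v w u)

    F a W gains : Fin n → ℕ
    F = Summary.F ∘ D
    a = Summary.a ∘ D
    W = Summary.W ∘ D
    κ : Fin n → Kind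
    κ = Summary.kind ∘ D
    gains = gain ∘ κ

    w-no-child : ¬ Child v w w
    w-no-child (_ , w≢w) = w≢w refl

    aw≡0 : a w ≡ 0
    aw≡0 = cong Summary.a (trivial w w-no-child)

    incoming : ∀ u → Incoming u v (a u)
    incoming u with child? v w u
    ... | yes c = inj₂ (proj₁ c , Correct.coloured (proj₂ (IH u c)))
    ... | no _  = inj₁ refl

    Q A : ℕ
    Q = proj₁ (optimum a)
    A = m + Q

    coloured : Coloured v w A
    coloured = combine v a incoming w aw≡0 Q (proj₁ (proj₂ (optimum a)))

    A≤t : A ≤ t
    A≤t = Coloured⇒≤ coloured

    Vs : Fin n → List (Fin n)
    Vs u with child? v w u
    ... | yes c = proj₁ (Correct.cover (proj₂ (IH u c)))
    ... | no _  = []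

    Vs-weight : ∀ u → weight R (Vs u) ≤ W u
    Vs-weight u with child? v w u
    ... | yes c = proj₂ (proj₂ (Correct.cover (proj₂ (IH u c))))
    ... | no _  = z≤n

    Vs-cover : ∀ u → Child v w u → ∀ {x} → Br u v x → x ∈ Vs u
    Vs-cover u c br with child? v w u
    ... | yes c′ = proj₁ (proj₂ (Correct.cover (proj₂ (IH u c′)))) br
    ... | no ¬c  = contradiction c ¬c

    cover : ∃ λ Vs → (∀ {x} → Br v w x → x ∈ Vs) × weight R Vs ≤ m + sum W
    cover = v ∷ concat (tabulate Vs) , complete ,
      +-monoʳ-≤ m (≤-trans (≤-reflexive (sum-map-concat (mult R) Vs)) (sum-mono Vs-weight))
      where
      complete : ∀ {x} → Br v w x → x ∈ v ∷ concat (tabulate Vs)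
      complete here = here refl
      complete (step {u} u~v u≢w br) = there (∈-concat⁺′ (Vs-cover u (u~v , u≢w) br) (∈-tabulate⁺ u))

    module At (b : ℕ) (inc : Incoming w v b) where

      α : Fin n → ℕ
      α = a [ w ]≔ b

      α-incoming : ∀ u → Incoming u v (α u)
      α-incoming = update-elim (λ u y → Incoming u v y) a w b inc (λ u _ → incoming u)

      αv≡0 : α v ≡ 0
      αv≡0 with α-incoming v
      ... | inj₁ eq        = eq
      ... | inj₂ (v~v , _) = contradiction refl (~⇒≢ v~v)

      through : ∀ u → ∃ (Optimal (α [ u ]≔ 0))
      through u = optimum (α [ u ]≔ 0)

      q c : Fin n → ℕ
      q u = proj₁ (through u)
      c u = a u ⊓ (t ∸ (m + q u))

      towards : ∀ u → Coloured v u (m + q u)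
      towards u = combine v (α [ u ]≔ 0)
        (update-elim (λ u′ y → Incoming u′ v y) α u 0 (inj₁ refl) (λ u′ _ → α-incoming u′))
        u (update-at α u 0) (q u) (proj₁ (proj₂ (through u)))

      m+q≤t : ∀ u → m + q u ≤ t
      m+q≤t u = Coloured⇒≤ (towards u)

      c≤t : ∀ u → 1 ≤ c u → c u + (m + q u) ≤ t
      c≤t u _ = ≤-trans (+-monoˡ-≤ (m + q u) (m⊓n≤n (a u) _)) (≤-reflexive (m∸n+n≡m (m+q≤t u)))

      M : ℕ
      M = proj₁ (optimum α)

      m+M≤t : m + M ≤ t
      m+M≤t = Coloured⇒≤ (combine v α α-incoming v αv≡0 M (proj₁ (proj₂ (optimum α))))

      module Bounds = Budget t m Q M b w a c q 1≤t (Incoming⇒≤ inc) (λ u → Incoming⇒≤ (incoming u)) aw≡0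
        (proj₂ (proj₂ (optimum a))) (proj₂ (proj₂ (optimum α))) m+M≤t
        (λ u → proj₂ (proj₂ (through u))) (≤-trans (m≤m+n m Q) A≤t) A≤t
        (λ u → m⊓n≤m (a u) _) c≤t

      e : Fin n → ℕ
      e = Bounds.e κ

      W≤ : ∀ u → W u ≤ t * F u + e u
      W≤ u with child? v w u
      -- The message m + `q u` that v returns to u takes the role of b in the induction hypothesis.
      ... | yes c = Correct.bound (proj₂ (IH u c)) (m + q u) (inj₂ (~-sym (proj₁ c) , towards u))
      ... | no _  = z≤n

      sum-W : m + sum W ≤ t * sum F + (m + sum e)
      sum-W = begin
        m + sum W                                 ≤⟨ +-monoʳ-≤ m (sum-mono W≤) ⟩
        m + sum (λ u → t * F u + e u)             ≡⟨ cong (m +_) (∑-distrib-+ (λ u → t * F u) e) ⟩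
        m + (sum (λ u → t * F u) + sum e)         ≡⟨ cong (λ x → m + (x + sum e)) (sym (*-distribˡ-sum t F)) ⟩
        m + (t * sum F + sum e)                   ≡⟨ swap m (t * sum F) (sum e) ⟩
        t * sum F + (m + sum e)                   ∎
        where
        open ≤-Reasoning
        swap : ∀ m x y → m + (x + y) ≡ x + (m + y)
        swap = solve-∀

    -- Children in N use `sel₁` and add their gain; the others use `sel₀`, so they stay silent and
    -- tolerate whatever v sends.
    choose : ∀ (vin : Bool) N o i → Unique N →
      length N + bit i ≤ 3 → (vin ≡ true → length N + bit i ≤ 1) →
      (∀ {u} → u ∈ N → tolerant (κ u) ≡ false → vin ≡ false × length N + bit i ≤ 2) →
      (o ≡ false → vin ≡ false × length N ≤ 1) →
      Sel v w (bit vin + (sum F + sumˡ (map gains N))) o i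
    choose vin N o i N! few few-v few-κ few-o =
      Sel-smaller (≤-reflexive (cong (bit vin +_) (sym total))) (Glue.glued v w vin σ ι ℓ N o i
        (λ u → does-true (u ∈? N)) no-child selection few few-v few-ι few-o)
      where
      σ ι : Fin n → Bool
      σ u = does (u ∈? N)
      ι u = if σ u then tolerant (κ u) else true
      ℓ : Fin n → ℕ
      ℓ u = F u + picked N gains u
      total : sum ℓ ≡ sum F + sumˡ (map gains N)
      total = trans (∑-distrib-+ F (picked N gains)) (cong (sum F +_) (sum-picked gains N!))
      no-child : ∀ u → ¬ Child v w u → ℓ u ≡ 0
      no-child u ¬c rewrite trivial u ¬c with does (u ∈? N)
      ... | true  = refl
      ... | false = refl
      selection : ∀ u → Child v w u → Sel u v (ℓ u) (σ u) (ι u)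
      selection u c with does (u ∈? N)
      ... | true  = Correct.sel₁ (correct u c)
      ... | false = Sel-smaller (≤-reflexive (+-identityʳ (F u))) (Correct.sel₀ (correct u c))
      few-ι : ∀ u → ι u ≡ false → vin ≡ false × u ∈ N × length N + bit i ≤ 2
      few-ι u ι≡ with u ∈? N
      ... | no _    = contradiction ι≡ λ ()
      ... | yes u∈N with few-κ u∈N ι≡
      ...   | vin≡ , ≤2 = vin≡ , u∈N , ≤2

    -- Here x is the excess of the new F over the sum of the children's F; after `sum-W`, the budget
    -- has to absorb only t x plus the surplus of kind k.
    finish : ∀ x k → Sel v w (sum F + x) false true → Sel v w (sum F + x + gain k) true (tolerant k) →
      (∀ b inc → m + sum (At.e b inc) ≤ t * x + surplus k A (A ⊓ (t ∸ b))) → Σ Summary (Correct v w)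
    finish x k sel₀ sel₁ bound = record { F = sum F + x ; kind = k ; a = A ; W = m + sum W } , record
      { coloured = coloured ; cover = cover ; sel₀ = sel₀ ; sel₁ = sel₁
      ; bound = λ b inc → ≤-trans (At.sum-W b inc) (≤-trans (+-monoʳ-≤ (t * sum F) (bound b inc))
          (≤-reflexive (distribute t (sum F) x (surplus k A (A ⊓ (t ∸ b)))))) }
      where
      distribute : ∀ t f x s → t * f + (t * x + s) ≡ t * (f + x) + s
      distribute = solve-∀

    t*2 : t * 2 ≡ t + t
    t*2 = double′ t
      where
      double′ : ∀ t → t * 2 ≡ t + t
      double′ = solve-∀

    tolerates : ∀ {u} → κ u ≡ loose → ∀ {B : Set} → tolerant (κ u) ≡ false → B
    tolerates lu rewrite lu = λ ()

    gain-of : ∀ {u k} → κ u ≡ k → gains u ≡ gain k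
    gain-of = cong gain

    -- A single sending child cannot generate v. With the parent there are two senders, few enough
    -- for a child of any kind.
    sel-0 : ∀ i → Sel v w (sum F + gains i) false true
    sel-0 i = Sel-smaller (≤-reflexive (cong (sum F +_) (sym (+-identityʳ (gains i)))))
      (choose false [ i ] false true ([] ∷ []) (s≤s (s≤s z≤n)) (λ ()) (λ _ _ → refl , ≤-refl) λ _ → refl , ≤-refl)

    sel-pair : ∀ i j → i ≢ j → Sel v w (sum F + (gains i + gains j)) true false
    sel-pair i j i≢j = Sel-smaller (≤-reflexive (cong (λ x → sum F + (gains i + x)) (sym (+-identityʳ (gains j)))))
      (choose false (i ∷ j ∷ []) true false ((i≢j ∷ []) ∷ [] ∷ []) (s≤s (s≤s z≤n)) (λ ()) (λ _ _ → refl , ≤-refl) λ ())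

    step-by : Pattern κ → Σ Summary (Correct v w)
    step-by (doubles i j i≢j di dj) = finish 2 double
      (subst (λ x → Sel v w (sum F + x) false true) (gain-of di) (sel-0 i))
      (Sel-smaller (≤-reflexive (trans (+-assoc (sum F) 2 2) (cong (sum F +_) (sym (cong₂ _+_ (gain-of di) (gain-of dj))))))
        (sel-pair i j i≢j))
      λ b inc → subst (λ x → m + sum (At.e b inc) ≤ x + (A + A ⊓ (t ∸ b))) (sym t*2) (At.Bounds.any-doubles b inc κ)
    step-by (double-plus i j i≢j di others nj) = finish 2 tight
      (subst (λ x → Sel v w (sum F + x) false true) (gain-of di) (sel-0 i))
      (Sel-smaller (≤-trans (≤-reflexive (+-assoc (sum F) 2 1)) (+-monoʳ-≤ (sum F)
          (+-mono-≤ (≤-reflexive (sym (gain-of di))) (positive (κ j) nj)))) (sel-pair i j i≢j))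
      λ b inc → subst (λ x → m + sum (At.e b inc) ≤ x + A ⊓ (t ∸ b)) (sym t*2) (At.Bounds.one-double b inc κ i di others)
      where
      positive : ∀ k → k ≢ null → 1 ≤ gain k
      positive null   h = contradiction refl h
      positive loose  _ = ≤-refl
      positive tight  _ = ≤-refl
      positive double _ = s≤s z≤n
    -- No further child has a gain, so sending brings nothing extra and `sel₁` is a relaxed `sel₀`.
    step-by (lone-double i di others) = finish 2 null sel₀
      (Sel-smaller (≤-reflexive (+-identityʳ _)) (Sel-relax false sel₀))
      λ b inc → subst (m + sum (At.e b inc) ≤_) (sym (trans (+-identityʳ (t * 2)) t*2)) (At.Bounds.only-double b inc κ i di others)
      where
      sel₀ = subst (λ x → Sel v w (sum F + x) false true) (gain-of di) (sel-0 i)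
    -- Three loose children may send together: each tolerates a message, and three senders cannot
    -- generate v twice. The first accounts for x = 1, the other two for the gain of `double`.
    step-by (loose-3 i j k i≢j i≢k j≢k ¬double li lj lk) = finish 1 double
      (subst (λ x → Sel v w (sum F + x) false true) (gain-of li) (sel-0 i))
      (Sel-smaller (≤-reflexive (trans (+-assoc (sum F) 1 2) (cong (sum F +_)
          (sym (cong₂ _+_ (gain-of li) (cong₂ _+_ (gain-of lj) (cong (_+ 0) (gain-of lk))))))))
        (choose false (i ∷ j ∷ k ∷ []) true false ((i≢j ∷ i≢k ∷ []) ∷ (j≢k ∷ []) ∷ [] ∷ []) ≤-refl (λ ())
          (λ { (here refl) → tolerates li ; (there (here refl)) → tolerates lj ; (there (there (here refl))) → tolerates lk })
          λ ()))
      λ b inc → subst (λ x → m + sum (At.e b inc) ≤ x + (A + A ⊓ (t ∸ b))) (sym (*-identityʳ t)) (At.Bounds.no-double b inc κ ¬double)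
    -- Two loose children and the parent again make three senders, so a message from the parent is
    -- tolerated.
    step-by (loose-2 i j i≢j ¬double li lj others) = finish 1 loose
      (subst (λ x → Sel v w (sum F + x) false true) (gain-of li) (sel-0 i))
      (Sel-smaller (≤-reflexive (trans (+-assoc (sum F) 1 1) (cong (sum F +_)
          (sym (cong₂ _+_ (gain-of li) (cong (_+ 0) (gain-of lj)))))))
        (choose false (i ∷ j ∷ []) true true ((i≢j ∷ []) ∷ [] ∷ []) ≤-refl (λ ())
          (λ { (here refl) → tolerates li ; (there (here refl)) → tolerates lj }) λ ()))
      λ b inc → subst (λ x → m + sum (At.e b inc) ≤ x + A) (sym (*-identityʳ t)) (At.Bounds.two-loose b inc κ ¬double i j others)
    -- Now v itself supplies the extra element. With v selected only one sender is allowed, and the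
    -- child i takes that place, so the parent must be silent.
    step-by (loose-1 i ¬double li others) = finish 1 tight
      (subst (λ x → Sel v w (sum F + x) false true) (gain-of li) (sel-0 i))
      (Sel-smaller (≤-reflexive (trans (+-comm (sum F + 1) 1) (cong (λ x → 1 + (sum F + x)) (sym (cong (_+ 0) (gain-of li))))))
        (choose true [ i ] true false ([] ∷ []) (s≤s z≤n) (λ _ → ≤-refl) (λ { (here refl) → tolerates li }) λ ()))
      λ b inc → subst (λ x → m + sum (At.e b inc) ≤ x + A ⊓ (t ∸ b)) (sym (*-identityʳ t)) (At.Bounds.one-loose b inc κ ¬double i others)
    -- With no loose child at all, `one-loose` applies with an arbitrary i.
    step-by (tights i j i≢j ¬double ¬loose ti tj) = finish 1 tight
      (subst (λ x → Sel v w (sum F + x) false true) (gain-of ti) (sel-0 i))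
      (Sel-smaller (≤-reflexive (trans (+-assoc (sum F) 1 1) (cong (sum F +_) (sym (cong₂ _+_ (gain-of ti) (gain-of tj))))))
        (sel-pair i j i≢j))
      λ b inc → subst (λ x → m + sum (At.e b inc) ≤ x + A ⊓ (t ∸ b)) (sym (*-identityʳ t))
        (At.Bounds.one-loose b inc κ ¬double i (λ u _ → ¬loose u))
    step-by (lone-tight i ti others) = finish 1 null sel₀
      (Sel-smaller (≤-reflexive (+-identityʳ _)) (Sel-relax false sel₀))
      λ b inc → subst (m + sum (At.e b inc) ≤_) (sym (trans (+-identityʳ (t * 1)) (*-identityʳ t))) (At.Bounds.only-tight b inc κ i ti others)
      where
      sel₀ = subst (λ x → Sel v w (sum F + x) false true) (gain-of ti) (sel-0 i)
    -- Again v supplies the gain; as no child sends, the parent may be the one permitted sender.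
    step-by (nulls all) = finish 0 loose
      (choose false [] false true [] (s≤s z≤n) (λ ()) (λ ()) λ _ → refl , z≤n)
      (Sel-smaller (≤-reflexive (+-comm (sum F + 0) 1)) (choose true [] true true [] (s≤s z≤n) (λ _ → ≤-refl) (λ ()) λ ()))
      λ b inc → subst (λ x → m + sum (At.e b inc) ≤ x + A) (sym (*-zeroʳ t)) (At.Bounds.all-null b inc κ all)

  summarise : ∀ {v w} → Wf v w → Σ Summary (Correct v w)
  summarise {v} {w} (node sub) = Step.step-by v w IH (classify (Step.κ v w IH))
    where
    IH : ∀ u → Child v w u → Σ Summary (Correct u v)
    IH u (u~v , u≢w) = summarise (sub u u~v u≢w)

  -- From the summary at the root to the inequality.

  -- Taking r as its own parent makes the branch the whole tree, and the condition on the parent's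
  -- message is vacuous since r is not adjacent to itself. Absence of repetition makes the two parts
  -- disjoint as sets.
  Sel⇒AntiRadon : ∀ {r ℓ i} → (∀ x → Br r r x) → (sel : Sel r r ℓ true i) → AntiRadon G 2 (Sel.S sel)
  Sel⇒AntiRadon {r} reach sel (f , x , inHull) =
    proj₂ (valid P (λ { s br (j , refl , _) → ∈-lookup j }) disjoint) (λ r~r → contradiction refl (~⇒≢ r~r)) (reach x)
      (gen false , gen true)
    where
    open Sel sel
    side : Bool → Fin 2
    side false = zero
    side true  = suc zero
    P : Bool → Fin n → Set
    P s = Part G S f (side s)
    gen : ∀ s → Gen (P s) x x
    gen s = hull⇒Gen (wf acyclic) (λ y → any? λ j → (lookup S j ≟ y) ×-dec (f j ≟ side s)) (inHull (side s))
    disjoint : ∀ {y} → Br r r y → P false y → ¬ P true y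
    disjoint _ (j , eq , fj≡) (j′ , eq′ , fj′≡) with lookup-injective unique j j′ (trans eq (sym eq′))
    ... | refl = contradiction (trans (sym fj≡) fj′≡) λ ()

  bounded : ∀ r → (∀ x → Br r r x) → ∃ λ S → AntiRadon G 2 S × length R ≤ t * length S
  bounded r reach = Sel.S sel₁ , Sel⇒AntiRadon reach sel₁ , (begin
    length R                               ≤⟨ length≤weight R Vs (λ x → complete (reach x)) ⟩
    weight R Vs                            ≤⟨ ≤W ⟩
    -- No message comes from beyond the root, so b is zero and c becomes `a ⊓ t`.
    W                                      ≤⟨ bound 0 (inj₁ refl) ⟩
    t * F + surplus kind a (a ⊓ t)         ≤⟨ +-monoʳ-≤ (t * F) (surplus≤ kind) ⟩
    t * F + t * gain kind                  ≡⟨ sym (*-distribˡ-+ t F (gain kind)) ⟩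
    t * (F + gain kind)                    ≤⟨ *-monoʳ-≤ t (Sel.size sel₁) ⟩
    t * length (Sel.S sel₁)                ∎)
    where
    open ≤-Reasoning
    result = summarise (wf acyclic r r)
    open Summary (proj₁ result)
    open Correct (proj₂ result)
    Vs = proj₁ cover
    complete = proj₁ (proj₂ cover)
    ≤W = proj₂ (proj₂ cover)
    a≤t : a ≤ t
    a≤t = Coloured⇒≤ coloured
    c≤t : a ⊓ t ≤ t
    c≤t = m⊓n≤n a t
    surplus≤ : ∀ k → surplus k a (a ⊓ t) ≤ t * gain k
    surplus≤ null   = z≤n
    surplus≤ loose  = ≤-trans a≤t (≤-reflexive (sym (*-identityʳ t)))
    surplus≤ tight  = ≤-trans c≤t (≤-reflexive (sym (*-identityʳ t)))
    surplus≤ double = ≤-trans (+-mono-≤ a≤t c≤t) (≤-reflexive (twice t))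
      where
      twice : ∀ t → t + t ≡ t * 2
      twice = solve-∀

theorem1 : ∀ {n : ℕ} (T : Graph n) → IsTree T → (k : ℕ) → 3 ≤ k →
    (R : List (Fin n)) → AntiRadon T k R →
    ∃ λ (S : List (Fin n)) → AntiRadon T 2 S × length R ≤ (k ∸ 1) * length S
theorem1 {suc n} T (_ , connected , acyclic) (suc t) (s≤s 2≤t) R anti =
  Radon.bounded T acyclic R t (≤-trans (s≤s z≤n) 2≤t) anti zero
    (λ x → Tree.walk⇒Br T (connected zero x))
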